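{- Let $p$ be a prime and let $k\in\mathbb{N}$ be relatively prime to $p$. If $M, n\in\mathbb{N}$ satisfy $\gamma_{p^n}(k)\leq M$ and $M-1\mid p^n-1$, then \[ v(p,k)\leq 2(M-1)+\mathbf{1}_M(\gamma_{p^n}(k)). \]
   Context: Let $F$ be an algebraically closed field of characteristic $p>0$. For $k\in\mathbb{N}$, $v(p,k)$ denotes the smallest natural number $s$ such that every polynomial in $F[t]$ can be written as a sum of at most $s$ $k$-th powers of polynomials in $F[t]$ (with no restriction on the degrees of the polynomials being raised to the $k$-th power); if no such $s$ exists, $v(p,k)=\infty$. For an integer $q\geq 2$, if $k=k_1q^{a_1}+\cdots+k_Nq^{a_N}$ is the base-$q$ expansion of $k$ (with $0\le k_i<q$), then $\gamma_q(k)=k_1+\cdots+k_N$ is the sum of the base-$q$ digits of $k$. The indicator function is $\mathbf{1}_M(x)=1$ if $x=M$ and $\mathbf{1}_M(x)=0$ if $x\neq M$. -}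

module Defs where

open import Algebra.Bundles using (CommutativeRing; RawSemiring; Semiring)
import Algebra.Definitions.RawSemiring as RawSemiringDefinitions
open import Axiom.ExcludedMiddle using (ExcludedMiddle)
open import Data.Bool.Base using (if_then_else_)
open import Data.Digit using (toDigits)
open import Data.Fin.Base using (toℕ)
open import Data.List.Base as List using (List; []; _∷_)
open import Data.Nat.Base
  using (ℕ; zero; suc; _≤_; _<_; _^_; NonZero; NonTrivial; n>1⇒nonTrivial; nonTrivial⇒n>1; >-nonZero⁻¹)
open import Data.Nat.Divisibility using (_∣_)
open import Data.Nat.Induction using (<-rec)
open import Data.Nat.ListAction using (sum)
open import Data.Nat.Primality using (Prime; prime⇒nonTrivial)
open import Data.Nat.Properties using (_≟_; ^-monoʳ-<; anyUpTo?; ≮⇒≥)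
open import Data.Product.Base using (Σ; ∃; ∃₂; _×_; _,_; proj₁)
open import Data.Vec.Functional using (Vector)
open import Function.Bundles using (_⇔_)
open import Level using (_⊔_)
open import Relation.Binary.Core using (Rel)
open import Relation.Nullary.Construct.Add.Supremum using (_⁺; ⊤⁺; [_])
open import Relation.Nullary.Decidable using (yes; no; does; fromWitness)
open import Relation.Nullary.Negation using (¬_)

module Polynomials {c ℓ} (R : CommutativeRing c ℓ) where

  open CommutativeRing R

  -- The list a₀ ∷ a₁ ∷ … ∷ aₙ ∷ [] is a₀ + a₁ t + … + aₙ tⁿ.  Trailing
  -- zeros are allowed; they are ignored by _≋_.
  Poly : Set c
  Poly = List Carrier

  coeff : Poly → ℕ → Carrier
  coeff []      _       = 0#
  coeff (a ∷ f) zero    = a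
  coeff (a ∷ f) (suc i) = coeff f i

  infix 4 _≋_
  _≋_ : Rel Poly ℓ
  f ≋ g = ∀ i → coeff f i ≈ coeff g i

  infixl 6 _+ₚ_
  _+ₚ_ : Poly → Poly → Poly
  []      +ₚ g       = g
  f       +ₚ []      = f
  (a ∷ f) +ₚ (b ∷ g) = (a + b) ∷ (f +ₚ g)

  infixl 7 _*ₚ_
  _*ₚ_ : Poly → Poly → Poly
  []      *ₚ g = []
  (a ∷ f) *ₚ g = List.map (a *_) g +ₚ (0# ∷ f *ₚ g)

  eval : Poly → Carrier → Carrier
  eval []      x = 0#
  eval (a ∷ f) x = a + x * eval f x

  Nonconstant : Poly → Set ℓ
  Nonconstant f = ∃ λ i → ¬ coeff f (suc i) ≈ 0#

  polyRawSemiring : RawSemiring c ℓ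
  polyRawSemiring = record
    { Carrier = Poly
    ; _≈_     = _≋_
    ; _+_     = _+ₚ_
    ; _*_     = _*ₚ_
    ; 0#      = []
    ; 1#      = 1# ∷ []
    }

module _ {c ℓ} (R : CommutativeRing c ℓ) where

  open CommutativeRing R
  open RawSemiringDefinitions (Semiring.rawSemiring semiring) using () renaming (_×_ to _·_)
  open Polynomials R

  record IsAlgebraicallyClosedField : Set (c ⊔ ℓ) where
    field
      0≉1     : ¬ 0# ≈ 1#
      inverse : ∀ x → ¬ x ≈ 0# → ∃ λ y → x * y ≈ 1#
      root    : ∀ f → Nonconstant f → ∃ λ x → eval f x ≈ 0#

  HasCharacteristic : ℕ → Set ℓ
  HasCharacteristic p = ∀ m → (m · 1# ≈ 0#) ⇔ (p ∣ m)

IsLeast : ∀ {a} → (ℕ → Set a) → ℕ ⁺ → Set a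
IsLeast P [ s ] = P s × (∀ m → P m → s ≤ m)
IsLeast P ⊤⁺    = ∀ m → ¬ P m

-- Excluded middle is what makes the minimum of an arbitrary set of
-- natural numbers available as an actual element of ℕ ∪ {∞}.
least : ∀ {a} → ExcludedMiddle a → (P : ℕ → Set a) → Σ (ℕ ⁺) (IsLeast P)
least em P with em {∃ P}
... | no ¬∃P       = ⊤⁺ , λ m Pm → ¬∃P (m , Pm)
... | yes (s , Ps) = <-rec (λ s → P s → Σ (ℕ ⁺) (IsLeast P)) step s Ps
  where
  step : ∀ s → (∀ {m} → m < s → P m → Σ (ℕ ⁺) (IsLeast P)) →
         P s → Σ (ℕ ⁺) (IsLeast P)
  step s rec Ps with anyUpTo? (λ m → em {P m}) s
  ... | yes (m , m<s , Pm) = rec m<s Pm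
  ... | no ¬smaller        =
    [ s ] , Ps , λ m Pm → ≮⇒≥ λ m<s → ¬smaller (m , m<s , Pm)

module Waring {c ℓ} (R : CommutativeRing c ℓ) where

  open Polynomials R
  open RawSemiringDefinitions polyRawSemiring using () renaming (_^_ to _^ₚ_; sum to sumₚ)

  EverySumOf≤ : (s k : ℕ) → Set (c ⊔ ℓ)
  EverySumOf≤ s k = ∀ (f : Poly) →
    ∃₂ λ m (g : Vector Poly m) → m ≤ s × f ≋ sumₚ (λ i → g i ^ₚ k)

  -- The characteristic is determined by R, so it is not an argument.
  v : ExcludedMiddle (c ⊔ ℓ) → ℕ → ℕ ⁺
  v em k = proj₁ (least em (λ s → EverySumOf≤ s k))

γ : (q : ℕ) → .{{NonTrivial q}} → ℕ → ℕ
γ q k = sum (List.map toℕ (proj₁ (toDigits q {fromWitness (nonTrivial⇒n>1 q)} k)))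

prime^-nonTrivial : ∀ {p} → Prime p → ∀ n → .{{NonZero n}} → NonTrivial (p ^ n)
prime^-nonTrivial {p} pr n =
  n>1⇒nonTrivial (^-monoʳ-< p (nonTrivial⇒n>1 p {{prime⇒nonTrivial pr}}) (>-nonZero⁻¹ n))

𝟏 : ℕ → ℕ → ℕ
𝟏 M x = if does (x ≟ M) then 1 else 0

{-# OPTIONS --safe #-}

-- Let q = p^n and m = M - 1.  Some power q^e is 1 modulo k; replacing every q^a
-- with a ≥ 1 in the base-q expansion of k by q · (q^(e+1))^(a-1) gives a multiple
-- K of k with the same digits, and it suffices to use K-th powers.  For ζ in F_q,
-- (1 + ζ y)^K is a product of γ_q(k) factors 1 + ζ y^(q^b), so the sum of
-- ζ⁻¹ (1 + ζ ρ y)^K over the m-th roots of unity ζ is a constant plus m times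
-- d ρ y + ρ^q G(y) + [γ_q(k) = M] (ρ y)^K, where ρ is any element fixed by
-- x ↦ x^(q^(e+1)) and d is the last digit of k.  Choosing ρ not fixed by x ↦ x^q
-- and subtracting ρ^q times the case ρ = 1 eliminates G, and one further K-th
-- power removes the y^K that is left when γ_q(k) = M.  What remains is affine in y
-- with nonzero slope, so y can be chosen to give any polynomial.
-- All identities are checked at the points of F, where polynomials that agree
-- everywhere have the same coefficients.
module Submission where

open import Defs
open import Level using (_⊔_; Lift; lift)
open import Algebra.Bundles using (CommutativeRing)
import Algebra.Definitions.RawSemiring as RawSemiringDefinitions
import Algebra.Properties.CommutativeSemiring.Binomial as Binomial
import Algebra.Properties.CommutativeSemiring.Exp as Exp
import Algebra.Properties.Ring as RingProperties
import Algebra.Properties.Semiring.Mult as Mult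
import Algebra.Properties.Semiring.Sum as Sum
import Algebra.Solver.Ring.NaturalCoefficients.Default as NaturalCoefficients
open import Axiom.ExcludedMiddle using (ExcludedMiddle)
open import Data.Bool.Base using (if_then_else_)
open import Data.Digit using (Expansion; fromDigits; toDigits)
open import Data.Fin.Base as Fin using (toℕ)
open import Data.Fin.Properties using (pigeonhole; toℕ<n; toℕ-fromℕ; toℕ-fromℕ<; toℕ-inject₁)
open import Data.List.Base as List
  using (List; []; _∷_; _++_; length; lookup; map; replicate; iterate; cartesianProductWith)
open import Data.List.Properties
  using (length-++; length-drop; length-iterate; length-map; length-replicate)
open import Data.List.Relation.Unary.All as All using (All; []; _∷_)
import Data.List.Relation.Unary.All.Properties as All
open import Data.Nat.Base as ℕ using (ℕ; zero; suc; _≤_; _<_; z≤n; s≤s; z<s)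
open import Data.Nat.Combinatorics using (_C_; nCk≡n!/k![n-k]!; nCn≡1)
open import Data.Nat.Combinatorics.Specification using ([n∸k]!k!∣n!)
open import Data.Nat.Coprimality using (Coprime; coprime-Bézout; coprime-divisor)
open import Data.Nat.Divisibility
open import Data.Nat.DivMod using (m≡m%n+[m/n]*n; m%n<n; m/n*n≡m)
open import Data.Nat.GCD using (module Bézout)
open import Data.Nat.ListAction using (sum; product)
open import Data.Nat.Primality
  using (Prime; euclidsLemma; prime⇒irreducible; prime⇒nonTrivial; productOfPrimes≥1; ¬prime[1])
open import Data.Nat.Primality.Factorisation using (PrimeFactorisation; factorise)
import Data.Nat.Properties as ℕ
open import Data.Nat.Tactic.RingSolver using (solve-∀)
open import Data.Product.Base using (∃; ∃₂; _,_; proj₁; proj₂) renaming (_×_ to _∧_)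
open import Data.Sum.Base using (inj₁; inj₂)
open import Function.Base using (_∘_; id; case_of_)
open import Function.Bundles using (Equivalence)
open import Relation.Binary.Construct.Add.Supremum.NonStrict _≤_ using (_≤⁺_; [_])
open import Relation.Binary.PropositionalEquality as ≡ using (_≡_)
import Relation.Binary.Reasoning.Setoid as SetoidReasoning
open import Relation.Nullary.Construct.Add.Supremum using ([_]; ⊤⁺)
open import Relation.Nullary.Decidable using (yes; no; dec-true; fromWitness)
open import Relation.Nullary.Negation using (¬_; contradiction)

-- Divisibility, powers modulo k, and digit lists read in different bases.

module Arithmetic where

  open import Data.Nat.Base
  open import Data.Nat.Properties
  open import Relation.Binary.PropositionalEquality

  prime∤! : ∀ {p} → Prime p → ∀ j → j < p → ¬ p ∣ j !
  prime∤! pr zero    j<p p∣1 = ¬prime[1] (subst Prime (∣1⇒≡1 p∣1) pr)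
  prime∤! pr (suc j) j<p p∣j! with euclidsLemma (suc j) (j !) pr p∣j!
  ... | inj₁ p∣j  = <⇒≱ j<p (∣⇒≤ p∣j)
  ... | inj₂ p∣j! = prime∤! pr j (<-trans (n<1+n j) j<p) p∣j!

  nCk*[k!*[n∸k]!]≡n! : ∀ {n k} → k ≤ n → (n C k) * (k ! * (n ∸ k) !) ≡ n !
  nCk*[k!*[n∸k]!]≡n! {n} {k} k≤n = trans
    (cong (_* (k ! * (n ∸ k) !)) (nCk≡n!/k![n-k]! k≤n))
    (m/n*n≡m (subst (_∣ n !) (*-comm ((n ∸ k) !) (k !)) ([n∸k]!k!∣n! k≤n)))
    where instance _ = k !* (n ∸ k) !≢0

  -- By Euclid's lemma: p divides p! = C(p, j) · j! · (p - j)! but neither of the two factorials on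
  -- the right.
  prime∣C : ∀ {p} → Prime p → ∀ j → 0 < j → j < p → p ∣ p C j
  prime∣C {p@(suc _)} pr j 0<j j<p
    with euclidsLemma (p C j) (j ! * (p ∸ j) !) pr
           (subst (p ∣_) (sym (nCk*[k!*[n∸k]!]≡n! (<⇒≤ j<p))) (m∣m*n _))
  ... | inj₁ p∣C = p∣C
  ... | inj₂ p∣! with euclidsLemma (j !) ((p ∸ j) !) pr p∣!
  ...   | inj₁ p∣j!    = contradiction p∣j! (prime∤! pr j j<p)
  ...   | inj₂ p∣[p-j]! =
    contradiction p∣[p-j]! (prime∤! pr (p ∸ j) (∸-monoʳ-< 0<j (<⇒≤ j<p)))

  -- A common divisor of k and q · q^i is coprime to q because it divides k, so it already divides
  -- q^i.
  coprime-^ : ∀ {k q} → Coprime k q → ∀ i → Coprime k (q ^ i)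
  coprime-^ c zero    (_ , d∣1) = ∣1⇒≡1 d∣1
  coprime-^ c (suc i) {d} (d∣k , d∣q*q^i) = coprime-^ c i
    (d∣k , coprime-divisor (λ (e∣d , e∣q) → c (∣-trans e∣d d∣k , e∣q)) d∣q*q^i)

  %-≡⇒∣∸ : ∀ {m n} k .{{_ : NonZero k}} → m % k ≡ n % k → m ≤ n → k ∣ n ∸ m
  %-≡⇒∣∸ {m} {n} k eq m≤n = divides (n / k ∸ m / k) (begin
    n ∸ m                                     ≡⟨ cong₂ _∸_ (m≡m%n+[m/n]*n n k) (m≡m%n+[m/n]*n m k) ⟩
    n % k + n / k * k ∸ (m % k + m / k * k)   ≡⟨ cong (λ r → n % k + n / k * k ∸ (r + m / k * k)) eq ⟩
    n % k + n / k * k ∸ (n % k + m / k * k)   ≡⟨ [m+n]∸[m+o]≡n∸o (n % k) _ _ ⟩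
    n / k * k ∸ m / k * k                     ≡⟨ *-distribʳ-∸ k (n / k) (m / k) ⟨
    (n / k ∸ m / k) * k                       ∎)
    where open ≡-Reasoning

  ^-∸-factor : ∀ q i e → q ^ (i + e) ∸ q ^ i ≡ q ^ i * (q ^ e ∸ 1)
  ^-∸-factor q i e = begin
    q ^ (i + e) ∸ q ^ i       ≡⟨ cong₂ _∸_ (^-distribˡ-+-* q i e) (sym (*-identityʳ (q ^ i))) ⟩
    q ^ i * q ^ e ∸ q ^ i * 1 ≡⟨ *-distribˡ-∸ (q ^ i) (q ^ e) 1 ⟨
    q ^ i * (q ^ e ∸ 1)       ∎
    where open ≡-Reasoning

  -- Two of the k + 1 powers q^0, ..., q^k leave the same remainder modulo k. Their difference is
  -- q^i (q^(e+1) - 1), and q^i is coprime to k, so k divides the other factor.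
  power≡1 : ∀ {k q} .{{_ : NonZero k}} .{{_ : NonZero q}} → Coprime k q →
            ∃₂ λ e c → q ^ suc e ≡ 1 + k * c
  power≡1 {k} {q} coprime
    with i , j , i<j , eq ← pigeonhole (n<1+n k) (λ i → Fin.fromℕ< (m%n<n (q ^ toℕ i) k))
    with e , 1+i+e≡j ← m≤n⇒∃[o]m+o≡n i<j
    with divides c q^1+e∸1≡c*k ← coprime-divisor (coprime-^ coprime (toℕ i))
           (subst (k ∣_)
             (trans
               (cong (λ j → q ^ j ∸ q ^ toℕ i) (sym (trans (+-suc (toℕ i) e) 1+i+e≡j)))
               (^-∸-factor q (toℕ i) (suc e)))
             (%-≡⇒∣∸ k
               (trans (sym (toℕ-fromℕ< _)) (trans (cong toℕ eq) (toℕ-fromℕ< _)))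
               (^-monoʳ-≤ q (<⇒≤ i<j))))
    = e , c , (begin
      q ^ suc e           ≡⟨ m+[n∸m]≡n (m^n>0 q (suc e)) ⟨
      1 + (q ^ suc e ∸ 1) ≡⟨ cong suc (trans q^1+e∸1≡c*k (*-comm c k)) ⟩
      1 + k * c           ∎)
    where open ≡-Reasoning

  -- Digits are plain numbers without a bound, so that the same list can be read in several bases.
  horner : ℕ → List ℕ → ℕ
  horner b []       = 0
  horner b (d ∷ ds) = d + b * horner b ds

  fromDigits≡horner : ∀ {b} (ds : Expansion b) → fromDigits ds ≡ horner b (List.map toℕ ds)
  fromDigits≡horner     []       = refl
  fromDigits≡horner {b} (d ∷ ds) = cong (toℕ d +_)
    (trans (*-comm (fromDigits ds) b) (cong (b *_) (fromDigits≡horner ds)))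

  -- The value is a polynomial in the base with natural coefficients, so adding a multiple of k to
  -- the base adds a multiple of k to it.
  horner-cong-mod : ∀ k {b b′ c} → b′ ≡ b + k * c →
                    ∀ ds → ∃ λ u → horner b′ ds ≡ horner b ds + k * u
  horner-cong-mod k             eq []       = 0 , sym (*-zeroʳ k)
  horner-cong-mod k {b} {c = c} refl (d ∷ ds) with u , eq ← horner-cong-mod k {b} {c = c} refl ds =
    c * horner b ds + (b + k * c) * u ,
    trans (cong (λ h → d + (b + k * c) * h) eq) (lemma d b k c u (horner b ds))
    where
    lemma : ∀ d b k c u h → d + (b + k * c) * (h + k * u) ≡ d + b * h + k * (c * h + (b + k * c) * u)
    lemma = solve-∀

  -- The sum 1 + q + ... + q^e, which is (q^(e+1) - 1)/(q - 1) for q > 1.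
  repunit : ℕ → ℕ → ℕ
  repunit q zero    = 1
  repunit q (suc e) = 1 + q * repunit q e

  ^-repunit : ∀ q e → suc q ^ suc e ≡ 1 + q * repunit (suc q) e
  ^-repunit q zero    = lemma q
    where
    lemma : ∀ q → suc q * 1 ≡ 1 + q * 1
    lemma = solve-∀
  ^-repunit q (suc e) = trans (cong (suc q *_) (^-repunit q e)) (lemma q (repunit (suc q) e))
    where
    lemma : ∀ q r → suc q * (1 + q * r) ≡ 1 + q * (1 + suc q * r)
    lemma = solve-∀

  -- As q^e ≡ 1 modulo k, each power q^a with a ≥ 1 in the expansion of k may be
  -- replaced by q · (q^(e+1))^(a-1), giving a multiple of k.
  spread-horner : ∀ {k q e c} → q ^ suc e ≡ 1 + k * c → ∀ d ds → horner q (d ∷ ds) ≡ k →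
                  ∃ λ l → d + q * horner (q ^ suc (suc e)) ds ≡ l * k
  spread-horner {k} {q} {e} {c} q^[1+e]≡1+kc d ds horner≡k =
    let u , eq = horner-cong-mod k {c = q * c} (trans (cong (q *_) q^[1+e]≡1+kc) (lemma q k c)) ds
    in  1 + q * u , trans (cong (λ h → d + q * h) eq)
          (trans (lemma′ d q (horner q ds) k u) (cong (_+ q * u * k) horner≡k))
    where
    lemma : ∀ q k c → q * (1 + k * c) ≡ q + k * (q * c)
    lemma = solve-∀
    lemma′ : ∀ d q h k u → d + q * (h + k * u) ≡ d + q * h + q * u * k
    lemma′ = solve-∀

  abstract
    -- Kept abstract: what follows depends on the property of `e` and not on the search that finds
    -- it. One `e` serves all digit lists of value k.
    spread-digits : ∀ {k q} .{{_ : NonZero k}} .{{_ : NonZero q}} → Coprime k q → ∃ λ e →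
                    ∀ d ds → horner q (d ∷ ds) ≡ k → ∃ λ l → d + q * horner (q ^ suc (suc e)) ds ≡ l * k
    spread-digits {q = q} coprime with e , c , q^[1+e]≡1+kc ← power≡1 coprime = e , spread-horner {q = q} {e} {c} q^[1+e]≡1+kc

open Arithmetic

-- Evaluation and coefficients of polynomials.

module Evaluation {c ℓ} (F : CommutativeRing c ℓ) where

  open CommutativeRing F
  open Polynomials F
  open Exp commutativeSemiring
  open Mult semiring
  open RawSemiringDefinitions polyRawSemiring using () renaming (_^_ to _^ₚ_; sum to sumₚ)
  open NaturalCoefficients commutativeSemiring using (solve; _:=_; _:+_; _:*_; con)
  open SetoidReasoning setoid

  eval-+ₚ : ∀ f g x → eval (f +ₚ g) x ≈ eval f x + eval g x
  eval-+ₚ []      g       x = sym (+-identityˡ _)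
  eval-+ₚ (a ∷ f) []      x = sym (+-identityʳ _)
  eval-+ₚ (a ∷ f) (b ∷ g) x = trans (+-congˡ (*-congˡ (eval-+ₚ f g x))) (lemma a b x _ _)
    where
    lemma : ∀ a b x u v → (a + b) + x * (u + v) ≈ (a + x * u) + (b + x * v)
    lemma = solve 5 (λ a b x u v → (a :+ b) :+ x :* (u :+ v) := (a :+ x :* u) :+ (b :+ x :* v)) refl

  eval-scale : ∀ a f x → eval (List.map (a *_) f) x ≈ a * eval f x
  eval-scale a []      x = sym (zeroʳ a)
  eval-scale a (b ∷ f) x = trans (+-congˡ (*-congˡ (eval-scale a f x))) (lemma a b x _)
    where
    lemma : ∀ a b x u → a * b + x * (a * u) ≈ a * (b + x * u)
    lemma = solve 4 (λ a b x u → a :* b :+ x :* (a :* u) := a :* (b :+ x :* u)) refl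

  eval-*ₚ : ∀ f g x → eval (f *ₚ g) x ≈ eval f x * eval g x
  eval-*ₚ []      g x = sym (zeroˡ _)
  eval-*ₚ (a ∷ f) g x = begin
    eval (List.map (a *_) g +ₚ (0# ∷ f *ₚ g)) x         ≈⟨ eval-+ₚ (List.map (a *_) g) _ x ⟩
    eval (List.map (a *_) g) x + (0# + x * eval (f *ₚ g) x)
      ≈⟨ +-cong (eval-scale a g x) (+-congˡ (*-congˡ (eval-*ₚ f g x))) ⟩
    a * eval g x + (0# + x * (eval f x * eval g x))     ≈⟨ lemma a x _ _ ⟩
    (a + x * eval f x) * eval g x                       ∎
    where
    lemma : ∀ a x u v → a * v + (0# + x * (u * v)) ≈ (a + x * u) * v
    lemma = solve 4 (λ a x u v → a :* v :+ (con 0 :+ x :* (u :* v)) := (a :+ x :* u) :* v) refl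

  eval-[_] : ∀ a x → eval (a ∷ []) x ≈ a
  eval-[ a ] x = trans (+-congˡ (zeroʳ x)) (+-identityʳ a)

  eval-^ₚ : ∀ f n x → eval (f ^ₚ n) x ≈ eval f x ^ n
  eval-^ₚ f zero    x = eval-[ 1# ] x
  eval-^ₚ f (suc n) x = trans (eval-*ₚ f (f ^ₚ n) x) (*-congˡ (eval-^ₚ f n x))

  -- Geometric summation, with the list of r ones as 1 + t + ... + t^(r-1); negative terms are moved
  -- across so that the semiring solver applies.
  geometric : ∀ r y → y * eval (replicate r 1#) y + 1# ≈ eval (replicate r 1#) y + y ^ r
  geometric zero    y = +-congʳ (zeroʳ y)
  geometric (suc r) y = begin
    y * (1# + y * G) + 1#  ≈⟨ +-congʳ (*-congˡ (+-comm 1# _)) ⟩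
    y * (y * G + 1#) + 1#  ≈⟨ +-congʳ (*-congˡ (geometric r y)) ⟩
    y * (G + y ^ r) + 1#   ≈⟨ lemma y G (y ^ r) ⟩
    1# + y * G + y * y ^ r ∎
    where
    G = eval (replicate r 1#) y
    lemma : ∀ y g u → y * (g + u) + 1# ≈ 1# + y * g + y * u
    lemma = solve 3 (λ y g u → y :* (g :+ u) :+ con 1 := con 1 :+ y :* g :+ y :* u) refl

  eval-ones : ∀ r {y} → y ≈ 1# → eval (replicate r 1#) y ≈ r × 1#
  eval-ones zero    y≈1 = refl
  eval-ones (suc r) y≈1 = +-congˡ (trans (*-cong y≈1 (eval-ones r y≈1)) (*-identityˡ _))

  X^_ : ℕ → Poly
  X^ zero  = 1# ∷ []
  X^ suc n = 0# ∷ X^ n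

  coeff-X^ : ∀ n → coeff (X^ n) n ≈ 1#
  coeff-X^ zero    = refl
  coeff-X^ (suc n) = coeff-X^ n

  eval-X^ : ∀ n x → eval (X^ n) x ≈ x ^ n
  eval-X^ zero    x = eval-[ 1# ] x
  eval-X^ (suc n) x = trans (+-identityˡ _) (*-congˡ (eval-X^ n x))

  1^n≈1 : ∀ n → 1# ^ n ≈ 1#
  1^n≈1 zero    = refl
  1^n≈1 (suc n) = trans (*-identityˡ _) (1^n≈1 n)

  coeff-+ₚ : ∀ f g i → coeff (f +ₚ g) i ≈ coeff f i + coeff g i
  coeff-+ₚ []      g       i       = sym (+-identityˡ _)
  coeff-+ₚ (a ∷ f) []      i       = sym (+-identityʳ _)
  coeff-+ₚ (a ∷ f) (b ∷ g) zero    = refl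
  coeff-+ₚ (a ∷ f) (b ∷ g) (suc i) = coeff-+ₚ f g i

  coeff-scale : ∀ a f i → coeff (List.map (a *_) f) i ≈ a * coeff f i
  coeff-scale a []      i       = sym (zeroʳ a)
  coeff-scale a (b ∷ f) zero    = refl
  coeff-scale a (b ∷ f) (suc i) = coeff-scale a f i

-- Roots and polynomial functions over an algebraically closed field.

module ClosedField {c ℓ} (F : CommutativeRing c ℓ) (closed : IsAlgebraicallyClosedField F) where

  open CommutativeRing F
  open Polynomials F
  open Evaluation F
  open Exp commutativeSemiring
  open Mult semiring
  open RingProperties ring using (-1*x≈-x; [y-z]x≈yx-zx; x[y-z]≈xy-xz; +-cancelʳ; x∙y⁻¹≈ε⇒x≈y; x≈y⇒x∙y⁻¹≈ε)
  open NaturalCoefficients commutativeSemiring using (solve; _:=_; _:*_)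
  open SetoidReasoning setoid

  open IsAlgebraicallyClosedField closed

  x*y≈0⇒y≈0 : ∀ {x y} → ¬ x ≈ 0# → x * y ≈ 0# → y ≈ 0#
  x*y≈0⇒y≈0 {x} {y} x≉0 xy≈0 with x⁻¹ , xx⁻¹≈1 ← inverse x x≉0 = begin
    y             ≈⟨ *-identityˡ y ⟨
    1# * y        ≈⟨ *-congʳ xx⁻¹≈1 ⟨
    x * x⁻¹ * y   ≈⟨ lemma x x⁻¹ y ⟩
    x⁻¹ * (x * y) ≈⟨ *-congˡ xy≈0 ⟩
    x⁻¹ * 0#      ≈⟨ zeroʳ x⁻¹ ⟩
    0#            ∎
    where
    lemma : ∀ x z y → x * z * y ≈ z * (x * y)
    lemma = solve 3 (λ x z y → x :* z :* y := z :* (x :* y)) refl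

  x*y≉0 : ∀ {x y} → ¬ x ≈ 0# → ¬ y ≈ 0# → ¬ x * y ≈ 0#
  x*y≉0 x≉0 y≉0 = y≉0 ∘ x*y≈0⇒y≈0 x≉0

  *-cancelˡ : ∀ {x y z} → ¬ x ≈ 0# → x * y ≈ x * z → y ≈ z
  *-cancelˡ {x} {y} {z} x≉0 xy≈xz = x∙y⁻¹≈ε⇒x≈y y z (x*y≈0⇒y≈0 x≉0
    (trans (x[y-z]≈xy-xz x y z) (x≈y⇒x∙y⁻¹≈ε xy≈xz)))

  nthRoot : ∀ n .{{_ : ℕ.NonZero n}} a → ∃ λ x → x ^ n ≈ a
  nthRoot (suc n) a
    -- The polynomial is t^(n+1) - a, and its leading coefficient 1 makes it nonconstant.
    with x , eq ← root (- a ∷ X^ n) (n , λ 1≈0 → 0≉1 (trans (sym 1≈0) (coeff-X^ n)))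
    = x , (begin
      x * x ^ n               ≈⟨ *-congˡ (eval-X^ n x) ⟨
      x * eval (X^ n) x       ≈⟨ +-identityˡ _ ⟨
      0# + x * eval (X^ n) x  ≈⟨ +-congʳ (-‿inverseʳ a) ⟨
      a - a + x * eval (X^ n) x ≈⟨ +-assoc _ _ _ ⟩
      a + (- a + x * eval (X^ n) x) ≈⟨ +-congˡ eq ⟩
      a + 0#                  ≈⟨ +-identityʳ a ⟩
      a                       ∎)

  -- A root y of 1 + t + ... + t^(r-1) satisfies y^r = 1, and y = 1 would give r = 0 in F. The bound
  -- r ≥ 2 makes this polynomial nonconstant.
  nontrivialUnityRoot : ∀ r → 2 ≤ r → ¬ r × 1# ≈ 0# → ∃ λ y → ¬ y ≈ 1# ∧ y ^ r ≈ 1#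
  nontrivialUnityRoot r@(suc (suc r-2)) (s≤s (s≤s z≤n)) r≉0
    with y , eq ← root (replicate r 1#) (0 , 0≉1 ∘ sym)
    = y , (λ y≈1 → r≉0 (trans (sym (eval-ones r y≈1)) eq)) , (begin
      y ^ r                                  ≈⟨ +-identityˡ _ ⟨
      0# + y ^ r                             ≈⟨ +-congʳ eq ⟨
      eval (replicate r 1#) y + y ^ r        ≈⟨ geometric r y ⟨
      y * eval (replicate r 1#) y + 1#       ≈⟨ +-congʳ (trans (*-congˡ eq) (zeroʳ y)) ⟩
      0# + 1#                                ≈⟨ +-identityˡ 1# ⟩
      1#                                     ∎)

  -- Multiplied by y - 1 ≠ 0, the sum becomes y^r - 1 = 0.
  geometric≈0 : ∀ r {y} → ¬ y ≈ 1# → y ^ r ≈ 1# → eval (replicate r 1#) y ≈ 0#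
  geometric≈0 r {y} y≉1 y^r≈1 = x*y≈0⇒y≈0 (y≉1 ∘ x∙y⁻¹≈ε⇒x≈y y 1#) (begin
    (y - 1#) * G   ≈⟨ [y-z]x≈yx-zx G y 1# ⟩
    y * G - 1# * G ≈⟨ x≈y⇒x∙y⁻¹≈ε (trans yG≈G (sym (*-identityˡ G))) ⟩
    0#             ∎)
    where
    G = eval (replicate r 1#) y
    yG≈G : y * G ≈ G
    yG≈G = +-cancelʳ 1# (y * G) G (trans (geometric r y) (+-congˡ y^r≈1))

  module _ (em : ExcludedMiddle (c ⊔ ℓ)) where

    -- If f vanished everywhere and had a nonzero coefficient, 1 + t f
    -- would be a nonconstant polynomial without roots.
    eval≈0⇒coeff≈0 : ∀ f → (∀ x → eval f x ≈ 0#) → ∀ i → coeff f i ≈ 0#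
    eval≈0⇒coeff≈0 f f≈0 i with em {Lift c (coeff f i ≈ 0#)}
    ... | yes (lift eq) = eq
    ... | no  ≉0 with x , eq ← root (1# ∷ f) (i , ≉0 ∘ lift) = contradiction
      (begin
        0#                ≈⟨ eq ⟨
        1# + x * eval f x ≈⟨ +-congˡ (trans (*-congˡ (f≈0 x)) (zeroʳ x)) ⟩
        1# + 0#           ≈⟨ +-identityʳ 1# ⟩
        1#                ∎)
      0≉1

    eval-injective : ∀ f g → (∀ x → eval f x ≈ eval g x) → f ≋ g
    eval-injective f g f≈g i = x∙y⁻¹≈ε⇒x≈y _ _ (begin
      coeff f i - coeff g i ≈⟨ +-congˡ (-1*x≈-x _) ⟨
      coeff f i + - 1# * coeff g i                    ≈⟨ +-congˡ (coeff-scale (- 1#) g i) ⟨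
      coeff f i + coeff (List.map (- 1# *_) g) i      ≈⟨ coeff-+ₚ f _ i ⟨
      coeff (f +ₚ List.map (- 1# *_) g) i             ≈⟨ eval≈0⇒coeff≈0 (f +ₚ List.map (- 1# *_) g) vanishes i ⟩
      0#                                              ∎)
      where
      vanishes : ∀ x → eval (f +ₚ List.map (- 1# *_) g) x ≈ 0#
      vanishes x = begin
        eval (f +ₚ List.map (- 1# *_) g) x ≈⟨ eval-+ₚ f _ x ⟩
        eval f x + eval (List.map (- 1# *_) g) x ≈⟨ +-cong (f≈g x) (eval-scale (- 1#) g x) ⟩
        eval g x + - 1# * eval g x         ≈⟨ +-congˡ (-1*x≈-x _) ⟩
        eval g x - eval g x                ≈⟨ -‿inverseʳ _ ⟩
        0#                                 ∎

-- Sums and products over lists, products of linear factors, sums over roots of unity.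

module ListSums {c ℓ} (F : CommutativeRing c ℓ) where

  open CommutativeRing F
  open Polynomials F
  open Evaluation F
  open Exp commutativeSemiring
  open Mult semiring
  open NaturalCoefficients commutativeSemiring using (solve; _:=_; _:+_; _:*_; con)
  open SetoidReasoning setoid

  ∑ : ∀ {a} {A : Set a} → (A → Carrier) → List A → Carrier
  ∑ f []       = 0#
  ∑ f (x ∷ xs) = f x + ∑ f xs

  ∏ : (Carrier → Carrier) → List Carrier → Carrier
  ∏ f []       = 1#
  ∏ f (x ∷ xs) = f x * ∏ f xs

  ∑-congᴬ : ∀ {a} {A : Set a} {f g : A → Carrier} {xs} → All (λ x → f x ≈ g x) xs → ∑ f xs ≈ ∑ g xs
  ∑-congᴬ []            = refl
  ∑-congᴬ (fx≈gx ∷ eqs) = +-cong fx≈gx (∑-congᴬ eqs)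

  ∑-cong : ∀ {a} {A : Set a} {f g : A → Carrier} → (∀ x → f x ≈ g x) → ∀ xs → ∑ f xs ≈ ∑ g xs
  ∑-cong f≈g xs = ∑-congᴬ (All.universal f≈g xs)

  ∑-+ : ∀ (f g : Carrier → Carrier) xs → ∑ (λ x → f x + g x) xs ≈ ∑ f xs + ∑ g xs
  ∑-+ f g []       = sym (+-identityˡ 0#)
  ∑-+ f g (x ∷ xs) = trans (+-congˡ (∑-+ f g xs)) (lemma (f x) (g x) _ _)
    where
    lemma : ∀ a b u v → a + b + (u + v) ≈ (a + u) + (b + v)
    lemma = solve 4 (λ a b u v → a :+ b :+ (u :+ v) := (a :+ u) :+ (b :+ v)) refl

  ∑-*ʳ : ∀ (f : Carrier → Carrier) a xs → ∑ (λ x → f x * a) xs ≈ ∑ f xs * a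
  ∑-*ʳ f a []       = sym (zeroˡ a)
  ∑-*ʳ f a (x ∷ xs) = trans (+-congˡ (∑-*ʳ f a xs)) (sym (distribʳ a (f x) _))

  ∑-1 : ∀ (xs : List Carrier) → ∑ (λ _ → 1#) xs ≈ length xs × 1#
  ∑-1 []       = refl
  ∑-1 (_ ∷ xs) = +-congˡ (∑-1 xs)

  ∑-++ : ∀ {a} {A : Set a} (f : A → Carrier) xs ys → ∑ f (xs ++ ys) ≈ ∑ f xs + ∑ f ys
  ∑-++ f []       ys = sym (+-identityˡ _)
  ∑-++ f (x ∷ xs) ys = trans (+-congˡ (∑-++ f xs ys)) (sym (+-assoc _ _ _))

  ∑-map : ∀ {a b} {A : Set a} {B : Set b} (f : B → Carrier) (g : A → B) xs →
          ∑ f (map g xs) ≈ ∑ (f ∘ g) xs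
  ∑-map f g []       = refl
  ∑-map f g (x ∷ xs) = +-congˡ (∑-map f g xs)

  ∏-++ : ∀ f xs ys → ∏ f (xs ++ ys) ≈ ∏ f xs * ∏ f ys
  ∏-++ f []       ys = sym (*-identityˡ _)
  ∏-++ f (x ∷ xs) ys = trans (*-congˡ (∏-++ f xs ys)) (sym (*-assoc _ _ _))

  ∑-replicate : ∀ (f : Carrier → Carrier) n x → ∑ f (replicate n x) ≈ (n × 1#) * f x
  ∑-replicate f zero    x = sym (zeroˡ _)
  ∑-replicate f (suc n) x = trans (+-congˡ (∑-replicate f n x)) (lemma (f x) _)
    where
    lemma : ∀ a u → a + u * a ≈ (1# + u) * a
    lemma = solve 2 (λ a u → a :+ u :* a := (con 1 :+ u) :* a) refl

  ∏-replicate : ∀ f n x → ∏ f (replicate n x) ≈ f x ^ n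
  ∏-replicate f zero    x = refl
  ∏-replicate f (suc n) x = *-congˡ (∏-replicate f n x)

  ∑^-map-* : ∀ j x ys → ∑ (_^ j) (map (x *_) ys) ≈ x ^ j * ∑ (_^ j) ys
  ∑^-map-* j x []       = sym (zeroʳ _)
  ∑^-map-* j x (y ∷ ys) = trans (+-cong (^-distrib-* x y j) (∑^-map-* j x ys)) (sym (distribˡ _ _ _))

  ∑^-product : ∀ j xs ys → ∑ (_^ j) (cartesianProductWith _*_ xs ys) ≈ ∑ (_^ j) xs * ∑ (_^ j) ys
  ∑^-product j []       ys = sym (zeroˡ _)
  ∑^-product j (x ∷ xs) ys = begin
    ∑ (_^ j) (map (x *_) ys ++ cartesianProductWith _*_ xs ys)
      ≈⟨ ∑-++ (_^ j) (map (x *_) ys) _ ⟩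
    ∑ (_^ j) (map (x *_) ys) + ∑ (_^ j) (cartesianProductWith _*_ xs ys)
      ≈⟨ +-cong (∑^-map-* j x ys) (∑^-product j xs ys) ⟩
    x ^ j * ∑ (_^ j) ys + ∑ (_^ j) xs * ∑ (_^ j) ys
      ≈⟨ distribʳ _ _ _ ⟨
    (x ^ j + ∑ (_^ j) xs) * ∑ (_^ j) ys ∎

  -- The list is a, ξ a, ξ^2 a, ..., so its j-th powers form a geometric progression of ratio ξ^j.
  ∑^-iterate : ∀ j ξ a n → ∑ (_^ j) (iterate (ξ *_) a n) ≈ a ^ j * eval (replicate n 1#) (ξ ^ j)
  ∑^-iterate j ξ a zero    = sym (zeroʳ _)
  ∑^-iterate j ξ a (suc n) = begin
    a ^ j + ∑ (_^ j) (iterate (ξ *_) (ξ * a) n)  ≈⟨ +-congˡ (∑^-iterate j ξ (ξ * a) n) ⟩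
    a ^ j + (ξ * a) ^ j * G                      ≈⟨ +-congˡ (*-congʳ (^-distrib-* ξ a j)) ⟩
    a ^ j + ξ ^ j * a ^ j * G                    ≈⟨ lemma (a ^ j) (ξ ^ j) G ⟩
    a ^ j * (1# + ξ ^ j * G)                     ∎
    where
    G = eval (replicate n 1#) (ξ ^ j)
    lemma : ∀ a x g → a + x * a * g ≈ a * (1# + x * g)
    lemma = solve 3 (λ a x g → a :+ x :* a :* g := a :* (con 1 :+ x :* g)) refl

  -- (1 + w t) f + w u, with u the carry in front of f.
  mulLinear : Carrier → Carrier → Poly → Poly
  mulLinear w u []      = w * u ∷ []
  mulLinear w u (a ∷ f) = (a + w * u) ∷ mulLinear w a f

  -- The coefficient of t^i is the i-th elementary symmetric function of the list; those for i = 0,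
  -- i = 1 and i equal to the length are computed below.
  linearProduct : List Carrier → Poly
  linearProduct []       = 1# ∷ []
  linearProduct (w ∷ ws) = mulLinear w 0# (linearProduct ws)

  eval-mulLinear : ∀ w u f x → eval (mulLinear w u f) x ≈ w * u + (1# + x * w) * eval f x
  eval-mulLinear w u []      x = +-congˡ (trans (zeroʳ x) (sym (zeroʳ _)))
  eval-mulLinear w u (a ∷ f) x = trans (+-congˡ (*-congˡ (eval-mulLinear w a f x))) (lemma a w u x _)
    where
    lemma : ∀ a w u x e → a + w * u + x * (w * a + (1# + x * w) * e) ≈ w * u + (1# + x * w) * (a + x * e)
    lemma = solve 5 (λ a w u x e → a :+ w :* u :+ x :* (w :* a :+ (con 1 :+ x :* w) :* e)
                                := w :* u :+ (con 1 :+ x :* w) :* (a :+ x :* e)) refl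

  eval-linearProduct : ∀ ws x → eval (linearProduct ws) x ≈ ∏ (λ w → 1# + x * w) ws
  eval-linearProduct []       x = eval-[ 1# ] x
  eval-linearProduct (w ∷ ws) x = begin
    eval (mulLinear w 0# (linearProduct ws)) x            ≈⟨ eval-mulLinear w 0# (linearProduct ws) x ⟩
    w * 0# + (1# + x * w) * eval (linearProduct ws) x     ≈⟨ +-cong (zeroʳ w) (*-congˡ (eval-linearProduct ws x)) ⟩
    0# + (1# + x * w) * ∏ (λ w → 1# + x * w) ws           ≈⟨ +-identityˡ _ ⟩
    (1# + x * w) * ∏ (λ w → 1# + x * w) ws                ∎

  length-mulLinear : ∀ w u f → length (mulLinear w u f) ≡ suc (length f)
  length-mulLinear w u []      = ≡.refl
  length-mulLinear w u (a ∷ f) = ≡.cong suc (length-mulLinear w a f)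

  length-linearProduct : ∀ ws → length (linearProduct ws) ≡ suc (length ws)
  length-linearProduct []       = ≡.refl
  length-linearProduct (w ∷ ws) =
    ≡.trans (length-mulLinear w 0# (linearProduct ws)) (≡.cong suc (length-linearProduct ws))

  coeff-mulLinear-0 : ∀ w f → coeff (mulLinear w 0# f) 0 ≈ coeff f 0
  coeff-mulLinear-0 w []      = zeroʳ w
  coeff-mulLinear-0 w (a ∷ f) = trans (+-congˡ (zeroʳ w)) (+-identityʳ a)

  coeff-mulLinear-suc : ∀ w u f i → coeff (mulLinear w u f) (suc i) ≈ coeff f (suc i) + w * coeff f i
  coeff-mulLinear-suc w u []          i       = sym (trans (+-identityˡ _) (zeroʳ w))
  coeff-mulLinear-suc w u (a ∷ [])    zero    = sym (+-identityˡ _)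
  coeff-mulLinear-suc w u (a ∷ b ∷ f) zero    = refl
  coeff-mulLinear-suc w u (a ∷ f)     (suc i) = coeff-mulLinear-suc w a f i

  coeff-≥length : ∀ f i → length f ≤ i → coeff f i ≈ 0#
  coeff-≥length []      i       _         = refl
  coeff-≥length (a ∷ f) (suc i) (s≤s f≤i) = coeff-≥length f i f≤i

  coeff-linearProduct-0 : ∀ ws → coeff (linearProduct ws) 0 ≈ 1#
  coeff-linearProduct-0 []       = refl
  coeff-linearProduct-0 (w ∷ ws) =
    trans (coeff-mulLinear-0 w (linearProduct ws)) (coeff-linearProduct-0 ws)

  coeff-linearProduct-1 : ∀ ws → coeff (linearProduct ws) 1 ≈ ∑ (λ w → w) ws
  coeff-linearProduct-1 []       = refl
  coeff-linearProduct-1 (w ∷ ws) = begin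
    coeff (linearProduct (w ∷ ws)) 1       ≈⟨ coeff-mulLinear-suc w 0# (linearProduct ws) 0 ⟩
    coeff (linearProduct ws) 1 + w * coeff (linearProduct ws) 0
      ≈⟨ +-cong (coeff-linearProduct-1 ws) (trans (*-congˡ (coeff-linearProduct-0 ws)) (*-identityʳ w)) ⟩
    ∑ (λ w → w) ws + w                     ≈⟨ +-comm _ w ⟩
    w + ∑ (λ w → w) ws                     ∎

  coeff-linearProduct-top : ∀ ws → coeff (linearProduct ws) (length ws) ≈ ∏ (λ w → w) ws
  coeff-linearProduct-top []       = refl
  coeff-linearProduct-top (w ∷ ws) = begin
    coeff (linearProduct (w ∷ ws)) (suc (length ws)) ≈⟨ coeff-mulLinear-suc w 0# (linearProduct ws) (length ws) ⟩
    coeff (linearProduct ws) (suc (length ws)) + w * coeff (linearProduct ws) (length ws)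
      -- `linearProduct ws` has degree at most the length of `ws`, so the first summand is 0.
      ≈⟨ +-cong (coeff-≥length (linearProduct ws) _ (ℕ.≤-reflexive (length-linearProduct ws)))
                (*-congˡ (coeff-linearProduct-top ws)) ⟩
    0# + w * ∏ (λ w → w) ws ≈⟨ +-identityˡ _ ⟩
    w * ∏ (λ w → w) ws ∎

  -- Roots of unity described by what the sums need, without a primitive root: how many there are,
  -- and which power sums vanish.
  record UnityRoots (m : ℕ) : Set (c Level.⊔ ℓ) where
    field
      roots     : List Carrier
      size      : length roots ≡ m
      isRoot    : All (λ ζ → ζ ^ m ≈ 1#) roots
      powerSum  : ∀ j → ¬ m ∣ j → ∑ (_^ j) roots ≈ 0#

  module _ {m} (μ : UnityRoots m) where
    open UnityRoots μ

    powerSum-m : ∑ (_^ m) roots ≈ m × 1#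
    powerSum-m = begin
      ∑ (_^ m) roots     ≈⟨ ∑-congᴬ isRoot ⟩
      ∑ (λ _ → 1#) roots ≈⟨ ∑-1 roots ⟩
      length roots × 1#  ≡⟨ ≡.cong (_× 1#) size ⟩
      m × 1#             ∎

    -- As deg f ≤ i, the powers of ζ that occur run from ζ^(j+1) to ζ^(i+j+1) = ζ^m, and all power
    -- sums before the last vanish. Each inductive step splits off the lowest power, lowering i and
    -- raising j.
    ∑-eval-tail : ∀ i j → i ℕ.+ suc j ≡ m → ∀ f → length f ≤ suc i →
                  ∑ (λ ζ → ζ ^ suc j * eval f ζ) roots ≈ (m × 1#) * coeff f i
    ∑-eval-tail i j i+1+j≡m [] _ = begin
      ∑ (λ ζ → ζ ^ suc j * 0#) roots ≈⟨ ∑-*ʳ (_^ suc j) 0# roots ⟩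
      ∑ (_^ suc j) roots * 0#        ≈⟨ zeroʳ _ ⟩
      0#                             ≈⟨ zeroʳ _ ⟨
      (m × 1#) * 0#                  ∎
    ∑-eval-tail zero j ≡.refl (a ∷ []) _ = begin
      ∑ (λ ζ → ζ ^ m * eval (a ∷ []) ζ) roots ≈⟨ ∑-cong (λ ζ → *-congˡ (eval-[ a ] ζ)) roots ⟩
      ∑ (λ ζ → ζ ^ m * a) roots               ≈⟨ ∑-*ʳ (_^ m) a roots ⟩
      ∑ (_^ m) roots * a                      ≈⟨ *-congʳ powerSum-m ⟩
      (m × 1#) * a                            ∎
    ∑-eval-tail zero j ≡.refl (a ∷ b ∷ f) (s≤s ())
    ∑-eval-tail (suc i) j i+2+j≡m (a ∷ f) (s≤s f≤i) = begin
      ∑ (λ ζ → ζ ^ suc j * (a + ζ * eval f ζ)) roots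
        ≈⟨ ∑-cong (λ ζ → lemma ζ (ζ ^ j) a (eval f ζ)) roots ⟩
      ∑ (λ ζ → ζ ^ suc j * a + ζ ^ suc (suc j) * eval f ζ) roots
        ≈⟨ ∑-+ (λ ζ → ζ ^ suc j * a) _ roots ⟩
      ∑ (λ ζ → ζ ^ suc j * a) roots + ∑ (λ ζ → ζ ^ suc (suc j) * eval f ζ) roots
        ≈⟨ +-cong (trans (∑-*ʳ (_^ suc j) a roots) (trans (*-congʳ (powerSum (suc j) m∤1+j)) (zeroˡ a)))
                  (∑-eval-tail i (suc j) (≡.trans (ℕ.+-suc i (suc j)) i+2+j≡m) f f≤i) ⟩
      0# + (m × 1#) * coeff f i ≈⟨ +-identityˡ _ ⟩
      (m × 1#) * coeff f i      ∎
      where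
      lemma : ∀ x u a e → x * u * (a + x * e) ≈ x * u * a + x * (x * u) * e
      lemma = solve 4 (λ x u a e → x :* u :* (a :+ x :* e) := x :* u :* a :+ x :* (x :* u) :* e) refl
      m∤1+j : ¬ m ∣ suc j
      m∤1+j m∣1+j = ℕ.<⇒≱ (ℕ.≤-trans (s≤s (ℕ.m≤n+m (suc j) i)) (ℕ.≤-reflexive i+2+j≡m)) (∣⇒≤ m∣1+j)

  -- Multiplying by ζ^(m-1) = ζ⁻¹ makes the sum pick out the coefficients
  -- of t and t^(m+1).
  ∑-extract : ∀ {m} (μ : UnityRoots (suc m)) → let open UnityRoots μ in
              ∀ f → length f ≤ 3 ℕ.+ m →
              ∑ (λ ζ → ζ ^ m * eval f ζ) roots ≈
              ∑ (_^ m) roots * coeff f 0 + (suc m × 1#) * (coeff f 1 + coeff f (2 ℕ.+ m))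
  ∑-extract {m} μ f f≤m+3 = begin
    ∑ (λ ζ → ζ ^ m * eval f ζ) roots
      ≈⟨ ∑-cong (λ ζ → *-congˡ (eval-split ζ)) roots ⟩
    ∑ (λ ζ → ζ ^ m * (f₀ + ζ * (f₁ + ζ * eval g ζ))) roots
      ≈⟨ ∑-congᴬ (All.map reduce isRoot) ⟩
    ∑ (λ ζ → ζ ^ m * f₀ + (1# * f₁ + ζ ^ 1 * eval g ζ)) roots
      ≈⟨ ∑-+ (λ ζ → ζ ^ m * f₀) _ roots ⟩
    ∑ (λ ζ → ζ ^ m * f₀) roots + ∑ (λ ζ → 1# * f₁ + ζ ^ 1 * eval g ζ) roots
      -- The sum of the ζ^m is 1 for m = 0 and 0 otherwise; it stays unevaluated because it only
      -- enters a constant. The tail `g` has degree at most m, so ζ g(ζ) reaches the exponent m + 1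
      -- only through the coefficient of t^m in `g`.
      ≈⟨ +-cong (∑-*ʳ (_^ m) f₀ roots) (trans (∑-+ (λ _ → 1# * f₁) _ roots)
           (+-cong (trans (∑-*ʳ (λ _ → 1#) f₁ roots) (*-congʳ (trans (∑-1 roots) (×-congˡ size))))
                   (∑-eval-tail μ m 0 (ℕ.+-comm m 1) g g≤m+1))) ⟩
    ∑ (_^ m) roots * f₀ + ((suc m × 1#) * f₁ + (suc m × 1#) * coeff g m)
      ≈⟨ +-congˡ (distribˡ _ _ _) ⟨
    ∑ (_^ m) roots * f₀ + (suc m × 1#) * (f₁ + coeff g m)
      ≈⟨ +-congˡ (*-congˡ (+-congˡ (reflexive (coeff-drop f m)))) ⟩
    ∑ (_^ m) roots * f₀ + (suc m × 1#) * (f₁ + coeff f (2 ℕ.+ m)) ∎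
    where
    open UnityRoots μ
    f₀ = coeff f 0
    f₁ = coeff f 1
    g  = List.drop 2 f
    g≤m+1 : length g ≤ suc m
    g≤m+1 = ℕ.≤-trans (ℕ.≤-reflexive (length-drop 2 f)) (ℕ.∸-monoˡ-≤ 2 f≤m+3)
    coeff-drop : ∀ f i → coeff (List.drop 2 f) i ≡ coeff f (2 ℕ.+ i)
    coeff-drop []          i = ≡.refl
    coeff-drop (_ ∷ [])    i = ≡.refl
    coeff-drop (_ ∷ _ ∷ f) i = ≡.refl
    eval-split : ∀ x → eval f x ≈ f₀ + x * (f₁ + x * eval g x)
    eval-split x = split f
      where
      0≈0+x*0 : 0# ≈ 0# + x * 0#
      0≈0+x*0 = sym (trans (+-identityˡ _) (zeroʳ x))
      split : ∀ f → eval f x ≈ coeff f 0 + x * (coeff f 1 + x * eval (List.drop 2 f) x)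
      split []          = trans 0≈0+x*0 (+-congˡ (*-congˡ 0≈0+x*0))
      split (a ∷ [])    = +-congˡ (*-congˡ 0≈0+x*0)
      split (a ∷ b ∷ f) = refl
    reduce : ∀ {ζ} → ζ ^ suc m ≈ 1# →
             ζ ^ m * (f₀ + ζ * (f₁ + ζ * eval g ζ)) ≈ ζ ^ m * f₀ + (1# * f₁ + ζ ^ 1 * eval g ζ)
    reduce {ζ} ζ^m+1≈1 = begin
      ζ ^ m * (f₀ + ζ * (f₁ + ζ * eval g ζ))                   ≈⟨ lemma (ζ ^ m) f₀ ζ f₁ (eval g ζ) ⟩
      ζ ^ m * f₀ + (ζ * ζ ^ m * f₁ + ζ * ζ ^ m * (ζ * 1# * eval g ζ))
        ≈⟨ +-congˡ (+-cong (*-congʳ ζ^m+1≈1) (trans (*-congʳ ζ^m+1≈1) (*-identityˡ _))) ⟩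
      ζ ^ m * f₀ + (1# * f₁ + ζ * 1# * eval g ζ)               ∎
      where
      lemma : ∀ u a x b e → u * (a + x * (b + x * e)) ≈ u * a + (x * u * b + x * u * (x * 1# * e))
      lemma = solve 5 (λ u a x b e → u :* (a :+ x :* (b :+ x :* e))
                := u :* a :+ (x :* u :* b :+ x :* u :* (x :* con 1 :* e))) refl

-- Prime characteristic: Frobenius maps, roots of unity, an element moved by q-th powers.

prime∤⇒coprime : ∀ {p n} → Prime p → ¬ p ∣ n → Coprime p n
prime∤⇒coprime pr p∤n (d∣p , d∣n) with prime⇒irreducible pr d∣p
... | inj₁ d≡1    = d≡1
... | inj₂ ≡.refl = contradiction d∣n p∤n

module PrimeCharacteristic
  {c ℓ} (F : CommutativeRing c ℓ) (closed : IsAlgebraicallyClosedField F)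
  (p : ℕ) (p-prime : Prime p) (char : HasCharacteristic F p) where

  open CommutativeRing F
  open IsAlgebraicallyClosedField closed using (0≉1)
  open Polynomials F
  open Evaluation F
  open ClosedField F closed
  open ListSums F
  open Exp commutativeSemiring
  open Mult semiring
  open Sum semiring using (sum-cong-≋; sum-replicate-zero; sum-init-last) renaming (sum to sumᵥ)
  open Binomial commutativeSemiring using (binomialTerm) renaming (theorem to binomialTheorem)
  open SetoidReasoning setoid

  p∣n⇒n×x≈0 : ∀ {n} x → p ∣ n → n × x ≈ 0#
  p∣n⇒n×x≈0 {n} x p∣n = begin
    n × x         ≈⟨ ×-congʳ n (*-identityˡ x) ⟨
    n × (1# * x)  ≈⟨ ×-assoc-* n 1# x ⟨
    (n × 1#) * x  ≈⟨ *-congʳ (Equivalence.from (char n) p∣n) ⟩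
    0# * x        ≈⟨ zeroˡ x ⟩
    0#            ∎

  p∤n⇒n×1≉0 : ∀ {n} → ¬ p ∣ n → ¬ n × 1# ≈ 0#
  p∤n⇒n×1≉0 {n} p∤n = p∤n ∘ Equivalence.to (char n)

  Additive : ℕ → Set _
  Additive q = ∀ x y → (x + y) ^ q ≈ x ^ q + y ^ q

  additive-* : ∀ q r → Additive q → Additive r → Additive (q ℕ.* r)
  additive-* q r add-q add-r x y = begin
    (x + y) ^ (q ℕ.* r)           ≈⟨ ^-assocʳ (x + y) q r ⟨
    ((x + y) ^ q) ^ r             ≈⟨ ^-congˡ r (add-q x y) ⟩
    (x ^ q + y ^ q) ^ r           ≈⟨ add-r _ _ ⟩
    (x ^ q) ^ r + (y ^ q) ^ r     ≈⟨ +-cong (^-assocʳ x q r) (^-assocʳ y q r) ⟩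
    x ^ (q ℕ.* r) + y ^ (q ℕ.* r) ∎

  additive-^ : ∀ q → Additive q → ∀ n → Additive (q ℕ.^ n)
  additive-^ q add-q zero    x y = trans (*-identityʳ _) (sym (+-cong (*-identityʳ x) (*-identityʳ y)))
  additive-^ q add-q (suc n) = additive-* q (q ℕ.^ n) add-q (additive-^ q add-q n)

  -- In the binomial expansion all inner coefficients are multiples of q. A fresh variable `q` in
  -- place of `p` allows the match on a successor that separates the two outer terms.
  frobenius : ∀ q → Prime q → (∀ n x → q ∣ n → n × x ≈ 0#) → Additive q
  frobenius q@(suc q-1) q-prime q∣n⇒n×x≈0 x y = begin
    (x + y) ^ q                        ≈⟨ binomialTheorem q x y ⟩
    term Fin.zero + sumᵥ (term ∘ Fin.suc)
      ≈⟨ +-cong (trans (×-homo-1 _) (*-identityˡ _)) (sum-init-last (term ∘ Fin.suc)) ⟩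
    y ^ q + (sumᵥ (term ∘ Fin.suc ∘ Fin.inject₁) + term (Fin.suc (Fin.fromℕ q-1)))
      ≈⟨ +-congˡ (+-cong (trans (sum-cong-≋ middle) (sum-replicate-zero q-1)) last) ⟩
    y ^ q + (0# + x ^ q)               ≈⟨ +-congˡ (+-identityˡ _) ⟩
    y ^ q + x ^ q                      ≈⟨ +-comm _ _ ⟩
    x ^ q + y ^ q                      ∎
    where
    term = binomialTerm x y q
    middle : ∀ i → term (Fin.suc (Fin.inject₁ i)) ≈ 0#
    middle i = q∣n⇒n×x≈0 _ _ (prime∣C q-prime (suc (toℕ (Fin.inject₁ i))) z<s
      (s≤s (≡.subst (_< q-1) (≡.sym (toℕ-inject₁ i)) (toℕ<n i))))
    last : term (Fin.suc (Fin.fromℕ q-1)) ≈ x ^ q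
    last = begin
      term (Fin.suc (Fin.fromℕ q-1))
        ≡⟨ ≡.cong (λ i → (q C suc i) × (x ^ suc i * y ^ (q-1 ℕ.∸ i))) (toℕ-fromℕ q-1) ⟩
      (q C q) × (x ^ q * y ^ (q-1 ℕ.∸ q-1))
        ≡⟨ ≡.cong₂ (λ b i → b × (x ^ q * y ^ i)) (nCn≡1 q) (ℕ.n∸n≡0 q-1) ⟩
      1 × (x ^ q * 1#)                         ≈⟨ trans (×-homo-1 _) (*-identityʳ _) ⟩
      x ^ q                                    ∎

  additive-p : Additive p
  additive-p = frobenius p p-prime (λ n x → p∣n⇒n×x≈0 x)

  x^[m*n]≈1 : ∀ {x} m n → x ^ m ≈ 1# → x ^ (m ℕ.* n) ≈ 1#
  x^[m*n]≈1 {x} m n x^m≈1 = trans (sym (^-assocʳ x m n)) (trans (^-congˡ n x^m≈1) (1^n≈1 n))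

  -- x = x · x^(b j) = x^(a l) = 1. Both signs in Bézout's identity reduce to this by swapping l and
  -- j.
  bézout⇒x≈1 : ∀ {x} l j a b → 1 ℕ.+ b ℕ.* j ≡ a ℕ.* l → x ^ l ≈ 1# → x ^ j ≈ 1# → x ≈ 1#
  bézout⇒x≈1 {x} l j a b 1+bj≡al x^l≈1 x^j≈1 = begin
    x                     ≈⟨ *-identityʳ x ⟨
    x * 1#                ≈⟨ *-congˡ (x^[m*n]≈1 j b x^j≈1) ⟨
    x ^ (1 ℕ.+ j ℕ.* b)   ≡⟨ ≡.cong (x ^_) (≡.trans (≡.cong suc (ℕ.*-comm j b)) (≡.trans 1+bj≡al (ℕ.*-comm a l))) ⟩
    x ^ (l ℕ.* a)         ≈⟨ x^[m*n]≈1 l a x^l≈1 ⟩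
    1#                    ∎

  x^l≈1∧x^j≈1⇒x≈1 : ∀ l j {x} → Coprime l j → x ^ l ≈ 1# → x ^ j ≈ 1# → x ≈ 1#
  x^l≈1∧x^j≈1⇒x≈1 l j coprime x^l≈1 x^j≈1 with coprime-Bézout coprime
  ... | Bézout.+- a b 1+bj≡al = bézout⇒x≈1 l j a b 1+bj≡al x^l≈1 x^j≈1
  ... | Bézout.-+ a b 1+al≡bj = bézout⇒x≈1 j l b a 1+al≡bj x^j≈1 x^l≈1

  iterate-isRoot : ∀ N {ξ a} n → ξ ^ N ≈ 1# → a ^ N ≈ 1# → All (λ ζ → ζ ^ N ≈ 1#) (iterate (ξ *_) a n)
  iterate-isRoot N zero    ξ^N≈1 a^N≈1 = []
  iterate-isRoot N {ξ} {a} (suc n) ξ^N≈1 a^N≈1 = a^N≈1 ∷ iterate-isRoot N n ξ^N≈1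
    (trans (^-distrib-* ξ a N) (trans (*-cong ξ^N≈1 a^N≈1) (*-identityˡ 1#)))

  unityRoots-1 : UnityRoots 1
  unityRoots-1 = record
    { roots    = 1# ∷ []
    ; size     = ≡.refl
    ; isRoot   = *-identityʳ 1# ∷ []
    ; powerSum = λ j 1∤j → contradiction (1∣ j) 1∤j
    }

  -- The roots of order l m are the products ξ^i η with i < l and η^m = 1,
  -- where ξ^m is a primitive l-th root of unity.
  unityRoots-* : ∀ {l m} .{{_ : ℕ.NonZero m}} → Prime l → ¬ p ∣ l → UnityRoots m → UnityRoots (l ℕ.* m)
  unityRoots-* {l} {m} l-prime p∤l μ
    with ω , ω≉1 , ω^l≈1 ← nontrivialUnityRoot l (ℕ.nonTrivial⇒n>1 l {{prime⇒nonTrivial l-prime}}) (p∤n⇒n×1≉0 p∤l)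
    with ξ , ξ^m≈ω ← nthRoot m ω = record
    { roots    = cartesianProductWith _*_ ξs roots
    ; size     = ≡.trans (length-product ξs) (≡.cong₂ ℕ._*_ (length-iterate (ξ *_) 1# l) size)
    ; isRoot   = All.cartesianProductWith⁺ (≡.setoid Carrier) (≡.setoid Carrier) _*_ ξs roots λ {x} {y} x∈ y∈ →
        trans (^-distrib-* x y (l ℕ.* m)) (trans (*-cong
          (All.lookup (iterate-isRoot (l ℕ.* m) l ξ^lm≈1 (1^n≈1 (l ℕ.* m))) x∈)
          (trans (^-congʳ y (ℕ.*-comm l m)) (x^[m*n]≈1 m l (All.lookup isRoot y∈)))) (*-identityˡ 1#))
    ; powerSum = λ j lm∤j → trans (∑^-product j ξs roots) (powerSum′ j lm∤j)
    }
    where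
    open UnityRoots μ
    ξs = iterate (ξ *_) 1# l
    length-product : ∀ xs → length (cartesianProductWith _*_ xs roots) ≡ length xs ℕ.* length roots
    length-product []       = ≡.refl
    length-product (x ∷ xs) = ≡.trans (length-++ (map (x *_) roots))
      (≡.cong₂ ℕ._+_ (length-map (x *_) roots) (length-product xs))
    ξ^lm≈1 : ξ ^ (l ℕ.* m) ≈ 1#
    ξ^lm≈1 = trans (^-congʳ ξ (ℕ.*-comm l m)) (trans (sym (^-assocʳ ξ m l)) (trans (^-congˡ l ξ^m≈ω) ω^l≈1))
    -- If m does not divide j, the sum over the roots of order m vanishes. Otherwise j = i m with i
    -- not divisible by l, and the other sum is geometric with ratio ω^i, an l-th root of unity
    -- different from 1.
    powerSum′ : ∀ j → ¬ l ℕ.* m ∣ j → ∑ (_^ j) ξs * ∑ (_^ j) roots ≈ 0#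
    powerSum′ j lm∤j with m ∣? j
    ... | no m∤j = trans (*-congˡ (powerSum j m∤j)) (zeroʳ _)
    ... | yes (divides i ≡.refl) = trans (*-congʳ (begin
      ∑ (_^ (i ℕ.* m)) ξs                         ≈⟨ ∑^-iterate (i ℕ.* m) ξ 1# l ⟩
      1# ^ (i ℕ.* m) * eval (replicate l 1#) (ξ ^ (i ℕ.* m)) ≈⟨ *-congˡ (geometric≈0 l ξ^im≉1 (begin
        (ξ ^ (i ℕ.* m)) ^ l    ≈⟨ ^-congˡ l ξ^im≈ω^i ⟩
        (ω ^ i) ^ l            ≈⟨ ^-assocʳ ω i l ⟩
        ω ^ (i ℕ.* l)          ≈⟨ ^-congʳ ω (ℕ.*-comm i l) ⟩
        ω ^ (l ℕ.* i)          ≈⟨ x^[m*n]≈1 l i ω^l≈1 ⟩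
        1#                     ∎)) ⟩
      1# ^ (i ℕ.* m) * 0#      ≈⟨ zeroʳ _ ⟩
      0#                       ∎)) (zeroˡ _)
      where
      ξ^im≈ω^i : ξ ^ (i ℕ.* m) ≈ ω ^ i
      ξ^im≈ω^i = trans (^-congʳ ξ (ℕ.*-comm i m)) (trans (sym (^-assocʳ ξ m i)) (^-congˡ i ξ^m≈ω))
      ξ^im≉1 : ¬ ξ ^ (i ℕ.* m) ≈ 1#
      ξ^im≉1 ξ^im≈1 = ω≉1 (x^l≈1∧x^j≈1⇒x≈1 l i (prime∤⇒coprime l-prime (lm∤j ∘ *-monoˡ-∣ m)) ω^l≈1
        (trans (sym ξ^im≈ω^i) ξ^im≈1))

  -- Built up one prime factor of m at a time; none of these is p because p does not divide m.
  unityRoots : ∀ m .{{_ : ℕ.NonZero m}} → ¬ p ∣ m → UnityRoots m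
  unityRoots m p∤m = ≡.subst UnityRoots (≡.sym isFactorisation)
    (build factors factorsPrime (p∤m ∘ ≡.subst (p ∣_) (≡.sym isFactorisation)))
    where
    open PrimeFactorisation (factorise m)
    build : ∀ ls → All Prime ls → ¬ p ∣ product ls → UnityRoots (product ls)
    build []       []              p∤ls = unityRoots-1
    build (l ∷ ls) (l-prime ∷ prs) p∤ls =
      unityRoots-* {{ℕ.>-nonZero (productOfPrimes≥1 prs)}} l-prime (p∤ls ∘ λ p∣l → ∣-trans p∣l (m∣m*n (product ls)))
        (build ls prs (p∤ls ∘ λ p∣ls → ∣-trans p∣ls (n∣m*n l)))

  -- The sum 1 + q + ... + q^e is 1 modulo q, hence modulo p.
  p∤repunit : ∀ {q} e → p ∣ q → ¬ p ∣ repunit q e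
  p∤repunit zero    p∣q p∣1   = ¬prime[1] (≡.subst Prime (∣1⇒≡1 p∣1) p-prime)
  p∤repunit (suc e) p∣q p∣1+q = ¬prime[1] (≡.subst Prime (∣1⇒≡1
    (∣m+n∣m⇒∣n (≡.subst (p ∣_) (ℕ.+-comm 1 _) p∣1+q) (∣m⇒∣m*n _ p∣q))) p-prime)

  repunit≥2 : ∀ q .{{_ : ℕ.NonZero q}} e → 2 ≤ repunit q (suc e)
  repunit≥2 q e = s≤s (ℕ.*-mono-≤ {x = 1} (ℕ.>-nonZero⁻¹ q) (repunit>0 e))
    where
    repunit>0 : ∀ e → 0 < repunit q e
    repunit>0 zero    = z<s
    repunit>0 (suc e) = z<s

  -- y = ρ^(q-1) is a nontrivial root of unity of order (q^(e+2) - 1)/(q - 1).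
  moved-by-q : ∀ q-1 .{{_ : ℕ.NonZero q-1}} e → p ∣ suc q-1 →
    ∃ λ ρ → ¬ ρ ^ suc q-1 ≈ ρ ∧ ρ ^ (suc q-1 ℕ.^ suc (suc e)) ≈ ρ
  moved-by-q q-1 e p∣q
    with y , y≉1 , y^r≈1 ← nontrivialUnityRoot (repunit (suc q-1) (suc e))
           (repunit≥2 (suc q-1) e) (p∤n⇒n×1≉0 (p∤repunit (suc e) p∣q))
    with ρ , ρ^q-1≈y ← nthRoot q-1 y = ρ , ρ^q≉ρ y≉1 y^r≈1 ρ^q-1≈y , (begin
      ρ ^ (suc q-1 ℕ.^ suc (suc e)) ≡⟨ ≡.cong (ρ ^_) (^-repunit q-1 (suc e)) ⟩
      ρ * ρ ^ (q-1 ℕ.* r)           ≈⟨ *-congˡ (^-assocʳ ρ q-1 r) ⟨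
      ρ * (ρ ^ q-1) ^ r             ≈⟨ *-congˡ (trans (^-congˡ r ρ^q-1≈y) y^r≈1) ⟩
      ρ * 1#                        ≈⟨ *-identityʳ ρ ⟩
      ρ                             ∎)
    where
    r = repunit (suc q-1) (suc e)
    ρ≉0 : ∀ {y ρ} → y ^ r ≈ 1# → ρ ^ q-1 ≈ y → ¬ ρ ≈ 0#
    ρ≉0 {y} {ρ} y^r≈1 ρ^q-1≈y ρ≈0 = 0≉1 (begin
      0#                            ≈⟨ zeroˡ _ ⟨
      -- The truncated subtraction is exact because (q - 1) r ≥ 1; it exposes one factor ρ of the
      -- power.
      0# * ρ ^ (q-1 ℕ.* r ℕ.∸ 1)    ≈⟨ *-congʳ ρ≈0 ⟨
      ρ ^ suc (q-1 ℕ.* r ℕ.∸ 1)     ≡⟨ ≡.cong (ρ ^_) (ℕ.m+[n∸m]≡n (ℕ.*-mono-≤ {x = 1} (ℕ.>-nonZero⁻¹ q-1) (s≤s z≤n))) ⟩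
      ρ ^ (q-1 ℕ.* r)               ≈⟨ ^-assocʳ ρ q-1 r ⟨
      (ρ ^ q-1) ^ r                 ≈⟨ ^-congˡ r ρ^q-1≈y ⟩
      y ^ r                         ≈⟨ y^r≈1 ⟩
      1#                            ∎)
    ρ^q≉ρ : ∀ {y ρ} → ¬ y ≈ 1# → y ^ r ≈ 1# → ρ ^ q-1 ≈ y → ¬ ρ ^ suc q-1 ≈ ρ
    ρ^q≉ρ {y} {ρ} y≉1 y^r≈1 ρ^q-1≈y ρ^q≈ρ = y≉1 (*-cancelˡ (ρ≉0 y^r≈1 ρ^q-1≈y) (begin
      ρ * y         ≈⟨ *-congˡ ρ^q-1≈y ⟨
      ρ * ρ ^ q-1   ≈⟨ ρ^q≈ρ ⟩
      ρ             ≈⟨ *-identityʳ ρ ⟨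
      ρ * 1#        ∎))

-- From affine combinations of K-th powers to sums of k-th powers.

module Representations
  {c ℓ} (em : ExcludedMiddle (c ⊔ ℓ)) (F : CommutativeRing c ℓ) (closed : IsAlgebraicallyClosedField F) where

  open CommutativeRing F
  open IsAlgebraicallyClosedField closed using (inverse)
  open Polynomials F
  open Waring F using (EverySumOf≤)
  open Evaluation F
  open ClosedField F closed
  open ListSums F
  open Exp commutativeSemiring
  open NaturalCoefficients commutativeSemiring using (solve; _:=_; _:+_; _:*_; con)
  open RawSemiringDefinitions polyRawSemiring using () renaming (_^_ to _^ₚ_; sum to sumₚ)
  open SetoidReasoning setoid

  eval-sumₚ-lookup : ∀ k gs x → eval (sumₚ (λ i → lookup gs i ^ₚ k)) x ≈ ∑ (λ g → eval g x ^ k) gs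
  eval-sumₚ-lookup k []       x = refl
  eval-sumₚ-lookup k (g ∷ gs) x =
    trans (eval-+ₚ (g ^ₚ k) (sumₚ (λ i → lookup gs i ^ₚ k)) x) (+-cong (eval-^ₚ g k x) (eval-sumₚ-lookup k gs x))

  -- The first entry, the coefficient in front of a power, may be arbitrary because it has a k-th
  -- root in F that can be moved into the base.
  Term : Set c
  Term = Carrier ∧ Carrier ∧ Carrier

  ⟦_⟧ : Term → ℕ → Carrier → Carrier
  ⟦ e , a , b ⟧ K y = e * (b + a * y) ^ K

  -- Once an affine function of y is a combination of K-th powers, any
  -- polynomial is, by solving for y; and K-th powers are k-th powers.
  affine⇒everySumOf≤ : ∀ k l .{{_ : ℕ.NonZero k}} (ts : List Term) {A B} → ¬ A ≈ 0# →
    (∀ y → ∑ (λ t → ⟦ t ⟧ (l ℕ.* k) y) ts ≈ B + A * y) → EverySumOf≤ (length ts) k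
  affine⇒everySumOf≤ k l ts {A} {B} A≉0 affine f =
    length gs , lookup gs , ℕ.≤-reflexive (length-map term ts) ,
    eval-injective em f (sumₚ (λ i → lookup gs i ^ₚ k)) λ x → begin
      eval f x                              ≈⟨ +-identityˡ _ ⟨
      0# + eval f x                         ≈⟨ +-congʳ (-‿inverseʳ B) ⟨
      B - B + eval f x                      ≈⟨ lemma₁ B (- B) (eval f x) ⟩
      B + (eval f x - B) * 1#               ≈⟨ +-congˡ (*-congˡ (proj₂ (inverse A A≉0))) ⟨
      B + (eval f x - B) * (A * A⁻¹)        ≈⟨ +-congˡ (lemma₂ (eval f x - B) A A⁻¹) ⟩
      B + A * (A⁻¹ * (eval f x - B))        ≈⟨ +-congˡ (*-congˡ (eval-X x)) ⟨
      B + A * eval X x                      ≈⟨ affine (eval X x) ⟨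
      ∑ (λ t → ⟦ t ⟧ (l ℕ.* k) (eval X x)) ts ≈⟨ ∑-cong (eval-term x) ts ⟨
      ∑ (λ t → eval (term t) x ^ k) ts      ≈⟨ ∑-map (λ g → eval g x ^ k) term ts ⟨
      ∑ (λ g → eval g x ^ k) gs             ≈⟨ eval-sumₚ-lookup k gs x ⟨
      eval (sumₚ (λ i → lookup gs i ^ₚ k)) x ∎
    where
    A⁻¹ = proj₁ (inverse A A≉0)

    X : Poly
    X = (A⁻¹ ∷ []) *ₚ (f +ₚ (- B ∷ []))

    eval-X : ∀ x → eval X x ≈ A⁻¹ * (eval f x - B)
    eval-X x = trans (eval-*ₚ (A⁻¹ ∷ []) (f +ₚ (- B ∷ [])) x)
      (*-cong (eval-[ A⁻¹ ] x) (trans (eval-+ₚ f (- B ∷ []) x) (+-congˡ (eval-[ - B ] x))))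

    term : Term → Poly
    -- A k-th root of `e` times an l-th power, so that the k-th power is `e` times an (l k)-th
    -- power.
    term (e , a , b) = (proj₁ (nthRoot k e) ∷ []) *ₚ ((b ∷ []) +ₚ (a ∷ []) *ₚ X) ^ₚ l

    gs = map term ts

    lemma₁ : ∀ b b′ u → b + b′ + u ≈ b + (u + b′) * 1#
    lemma₁ = solve 3 (λ b b′ u → b :+ b′ :+ u := b :+ (u :+ b′) :* con 1) refl

    lemma₂ : ∀ u a a′ → u * (a * a′) ≈ a * (a′ * u)
    lemma₂ = solve 3 (λ u a a′ → u :* (a :* a′) := a :* (a′ :* u)) refl

    eval-term : ∀ x t → eval (term t) x ^ k ≈ ⟦ t ⟧ (l ℕ.* k) (eval X x)
    eval-term x (e , a , b) with e′ , e′^k≈e ← nthRoot k e = begin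
      eval ((e′ ∷ []) *ₚ h ^ₚ l) x ^ k          ≈⟨ ^-congˡ k (trans (eval-*ₚ (e′ ∷ []) (h ^ₚ l) x)
                                                     (*-cong (eval-[ e′ ] x) (eval-^ₚ h l x))) ⟩
      (e′ * eval h x ^ l) ^ k                   ≈⟨ ^-distrib-* e′ _ k ⟩
      e′ ^ k * (eval h x ^ l) ^ k               ≈⟨ *-cong e′^k≈e (^-assocʳ _ l k) ⟩
      e * eval h x ^ (l ℕ.* k)                  ≈⟨ *-congˡ (^-congˡ (l ℕ.* k) (trans (eval-+ₚ (b ∷ []) ((a ∷ []) *ₚ X) x)
                                                     (+-cong (eval-[ b ] x) (trans (eval-*ₚ (a ∷ []) X x)
                                                       (*-congʳ (eval-[ a ] x)))))) ⟩
      e * (b + a * eval X x) ^ (l ℕ.* k)        ∎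
      where h = (b ∷ []) +ₚ (a ∷ []) *ₚ X

-- Digit expansions and the sum over roots of unity.

module DigitSums
  {c ℓ} (em : ExcludedMiddle (c ⊔ ℓ)) (F : CommutativeRing c ℓ) (closed : IsAlgebraicallyClosedField F)
  (p : ℕ) (p-prime : Prime p) (char : HasCharacteristic F p) where

  open CommutativeRing F
  open Polynomials F
  open Waring F using (EverySumOf≤)
  open Evaluation F
  open ClosedField F closed
  open ListSums F
  open PrimeCharacteristic F closed p p-prime char
  open Representations em F closed
  open Exp commutativeSemiring
  open Mult semiring
  open RingProperties ring using (x∙y⁻¹≈ε⇒x≈y)
  open NaturalCoefficients commutativeSemiring using (solve; _:=_; _:+_; _:*_; con)
  open SetoidReasoning setoid

  -- Contains z^(D^a) as often as the a-th digit says, so its length is the digit sum and its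
  -- product is z to the power `horner D ds`.
  digitPowers : ℕ → List ℕ → Carrier → List Carrier
  digitPowers D []       z = []
  digitPowers D (d ∷ ds) z = replicate d z ++ digitPowers D ds (z ^ D)

  length-digitPowers : ∀ D ds z → length (digitPowers D ds z) ≡ sum ds
  length-digitPowers D []       z = ≡.refl
  length-digitPowers D (d ∷ ds) z = ≡.trans (length-++ (replicate d z))
    (≡.cong₂ ℕ._+_ (length-replicate d) (length-digitPowers D ds (z ^ D)))

  -- As f commutes with D-th powers, an entry z^(D^a) contributes the factor f(z)^(D^a).
  ∏-digitPowers : ∀ D f → (∀ z → f (z ^ D) ≈ f z ^ D) →
                  ∀ ds z → ∏ f (digitPowers D ds z) ≈ f z ^ horner D ds
  ∏-digitPowers D f f-^D []       z = refl
  ∏-digitPowers D f f-^D (d ∷ ds) z = begin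
    ∏ f (replicate d z ++ digitPowers D ds (z ^ D)) ≈⟨ ∏-++ f (replicate d z) _ ⟩
    ∏ f (replicate d z) * ∏ f (digitPowers D ds (z ^ D))
      ≈⟨ *-cong (∏-replicate f d z) (∏-digitPowers D f f-^D ds (z ^ D)) ⟩
    f z ^ d * f (z ^ D) ^ horner D ds               ≈⟨ *-congˡ (^-congˡ (horner D ds) (f-^D z)) ⟩
    f z ^ d * (f z ^ D) ^ horner D ds               ≈⟨ *-congˡ (^-assocʳ (f z) D (horner D ds)) ⟩
    f z ^ d * f z ^ (D ℕ.* horner D ds)             ≈⟨ ^-homo-* (f z) d _ ⟨
    f z ^ (d ℕ.+ D ℕ.* horner D ds)                 ∎

  -- An entry z^(D^i) is multiplied by a^(D^i) = a. Taking `z′` up to equality lets the induction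
  -- pass to the D-th powers of `z` and `z′`.
  ∑-digitPowers-scale : ∀ D {a} → a ^ D ≈ a → ∀ ds {z z′} → z′ ≈ a * z →
                        ∑ id (digitPowers D ds z′) ≈ a * ∑ id (digitPowers D ds z)
  ∑-digitPowers-scale D {a} a^D≈a []       z′≈az = sym (zeroʳ a)
  ∑-digitPowers-scale D {a} a^D≈a (d ∷ ds) {z} {z′} z′≈az = begin
    ∑ id (replicate d z′ ++ digitPowers D ds (z′ ^ D))   ≈⟨ ∑-++ id (replicate d z′) _ ⟩
    ∑ id (replicate d z′) + ∑ id (digitPowers D ds (z′ ^ D))
      ≈⟨ +-cong (∑-replicate id d z′) (∑-digitPowers-scale D a^D≈a ds
           (trans (^-congˡ D z′≈az) (trans (^-distrib-* a z D) (*-congʳ a^D≈a)))) ⟩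
    (d × 1#) * z′ + a * ∑ id (digitPowers D ds (z ^ D))  ≈⟨ +-congʳ (*-congˡ z′≈az) ⟩
    (d × 1#) * (a * z) + a * ∑ id (digitPowers D ds (z ^ D)) ≈⟨ lemma (d × 1#) a z _ ⟩
    a * ((d × 1#) * z + ∑ id (digitPowers D ds (z ^ D))) ≈⟨ *-congˡ (+-congʳ (∑-replicate id d z)) ⟨
    a * (∑ id (replicate d z) + ∑ id (digitPowers D ds (z ^ D))) ≈⟨ *-congˡ (∑-++ id (replicate d z) _) ⟨
    a * ∑ id (replicate d z ++ digitPowers D ds (z ^ D)) ∎
    where
    lemma : ∀ d a z s → d * (a * z) + a * s ≈ a * (d * z + s)
    lemma = solve 4 (λ d a z s → d :* (a :* z) :+ a :* s := a :* (d :* z :+ s)) refl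

  1+ζz-^ : ∀ q {ζ} → Additive q → ζ ^ q ≈ ζ → ∀ z → 1# + ζ * z ^ q ≈ (1# + ζ * z) ^ q
  1+ζz-^ q {ζ} additive ζ^q≈ζ z = sym (begin
    (1# + ζ * z) ^ q      ≈⟨ additive 1# (ζ * z) ⟩
    1# ^ q + (ζ * z) ^ q  ≈⟨ +-cong (1^n≈1 q) (^-distrib-* ζ z q) ⟩
    1# + ζ ^ q * z ^ q    ≈⟨ +-congˡ (*-congʳ ζ^q≈ζ) ⟩
    1# + ζ * z ^ q        ∎)

  -- With D = q^(e+1) the exponent below is the multiple of k from spread-digits.
  module _ (q D d : ℕ) (ds : List ℕ) where

    exponent : ℕ
    exponent = d ℕ.+ q ℕ.* horner D ds

    -- The last digit is kept apart: if ρ^D = ρ, replacing z by ρ z multiplies its `d` entries by ρ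
    -- and all the others by ρ^q.
    factors : Carrier → List Carrier
    factors z = replicate d z ++ digitPowers D ds (z ^ q)

    length-factors : ∀ z → length (factors z) ≡ d ℕ.+ sum ds
    length-factors z = ≡.trans (length-++ (replicate d z))
      (≡.cong₂ ℕ._+_ (length-replicate d) (length-digitPowers D ds (z ^ q)))

    -- Used with f(w) = 1 + ζ w to factor a power of 1 + ζ z, and with the identity to find the top
    -- coefficient.
    ∏-factors : ∀ f → (∀ z → f (z ^ q) ≈ f z ^ q) → (∀ z → f (z ^ D) ≈ f z ^ D) →
                ∀ z → ∏ f (factors z) ≈ f z ^ exponent
    ∏-factors f f-^q f-^D z = begin
      ∏ f (factors z)                                ≈⟨ ∏-++ f (replicate d z) _ ⟩
      ∏ f (replicate d z) * ∏ f (digitPowers D ds (z ^ q))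
        ≈⟨ *-cong (∏-replicate f d z) (∏-digitPowers D f f-^D ds (z ^ q)) ⟩
      f z ^ d * f (z ^ q) ^ horner D ds              ≈⟨ *-congˡ (^-congˡ (horner D ds) (f-^q z)) ⟩
      f z ^ d * (f z ^ q) ^ horner D ds              ≈⟨ *-congˡ (^-assocʳ (f z) q (horner D ds)) ⟩
      f z ^ d * f z ^ (q ℕ.* horner D ds)            ≈⟨ ^-homo-* (f z) d _ ⟨
      f z ^ exponent                                 ∎

    -- For digit sums up to m + 2, the only coefficient besides those of degree 0 and 1 that
    -- survives summation over m + 1 roots of unity. It is the top coefficient exactly when the
    -- digit sum is m + 2.
    remainder : ℕ → Carrier → Carrier
    remainder m z = coeff (linearProduct (factors z)) (2 ℕ.+ m)

    remainder≈0 : ∀ m → d ℕ.+ sum ds < 2 ℕ.+ m → ∀ z → remainder m z ≈ 0#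
    remainder≈0 m γ<m+2 z = coeff-≥length (linearProduct (factors z)) (2 ℕ.+ m)
      (≡.subst (ℕ._≤ 2 ℕ.+ m) (≡.sym (≡.trans (length-linearProduct (factors z)) (≡.cong suc (length-factors z)))) γ<m+2)

    remainder≈z^exponent : ∀ m → d ℕ.+ sum ds ≡ 2 ℕ.+ m → ∀ z → remainder m z ≈ z ^ exponent
    remainder≈z^exponent m γ≡m+2 z = begin
      coeff (linearProduct (factors z)) (2 ℕ.+ m)
        ≡⟨ ≡.cong (coeff (linearProduct (factors z))) (≡.sym (≡.trans (length-factors z) γ≡m+2)) ⟩
      coeff (linearProduct (factors z)) (length (factors z)) ≈⟨ coeff-linearProduct-top (factors z) ⟩
      ∏ id (factors z)                                       ≈⟨ ∏-factors id (λ _ → refl) (λ _ → refl) z ⟩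
      z ^ exponent                                           ∎

    module _ {m} (μ : UnityRoots (suc m)) (additive-q : Additive q) (additive-D : Additive D)
             (γ≤m+2 : d ℕ.+ sum ds ≤ 2 ℕ.+ m) where
      open UnityRoots μ

      -- For fixed z the power of 1 + ζ z is the value at ζ of `linearProduct (factors z)`, of
      -- degree at most m + 2, so `∑-extract` applies. The coefficient of degree 1 is the sum of the
      -- entries: `d` copies of z and the digit powers of z^q.
      ∑-powers : All (λ ζ → ζ ^ q ≈ ζ) roots → All (λ ζ → ζ ^ D ≈ ζ) roots → ∀ z →
        ∑ (λ ζ → ζ ^ m * (1# + ζ * z) ^ exponent) roots ≈
        ∑ (_^ m) roots + (suc m × 1#) * ((d × 1#) * z + ∑ id (digitPowers D ds (z ^ q)) + remainder m z)
      ∑-powers fixed-q fixed-D z = begin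
        ∑ (λ ζ → ζ ^ m * (1# + ζ * z) ^ exponent) roots
          ≈⟨ ∑-congᴬ (All.zipWith (λ {ζ} (ζ^q≈ζ , ζ^D≈ζ) → *-congˡ (trans
               (sym (∏-factors (λ w → 1# + ζ * w) (1+ζz-^ q additive-q ζ^q≈ζ) (1+ζz-^ D additive-D ζ^D≈ζ) z))
               (sym (eval-linearProduct (factors z) ζ)))) (fixed-q , fixed-D)) ⟩
        ∑ (λ ζ → ζ ^ m * eval (linearProduct (factors z)) ζ) roots
          ≈⟨ ∑-extract μ (linearProduct (factors z))
               (≡.subst (ℕ._≤ 3 ℕ.+ m) (≡.sym (≡.trans (length-linearProduct (factors z))
                 (≡.cong suc (length-factors z)))) (s≤s γ≤m+2)) ⟩
        ∑ (_^ m) roots * coeff (linearProduct (factors z)) 0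
          + (suc m × 1#) * (coeff (linearProduct (factors z)) 1 + remainder m z)
          ≈⟨ +-cong (trans (*-congˡ (coeff-linearProduct-0 (factors z))) (*-identityʳ _))
                    (*-congˡ (+-congʳ (trans (coeff-linearProduct-1 (factors z))
                      (trans (∑-++ id (replicate d z) _) (+-congʳ (∑-replicate id d z)))))) ⟩
        ∑ (_^ m) roots + (suc m × 1#) * ((d × 1#) * z + ∑ id (digitPowers D ds (z ^ q)) + remainder m z) ∎

      module _ (fixed-q : All (λ ζ → ζ ^ q ≈ ζ) roots) (fixed-D : All (λ ζ → ζ ^ D ≈ ζ) roots)
               {ρ} (ρ^q≉ρ : ¬ ρ ^ q ≈ ρ) (ρ^D≈ρ : ρ ^ D ≈ ρ) (d≉0 : ¬ d × 1# ≈ 0#) (m≉0 : ¬ suc m × 1# ≈ 0#) where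

        private
          K = exponent
          σ = - (ρ ^ q)
          δ = d × 1#
          ν = suc m × 1#
          s = ∑ (_^ m) roots
          A = ν * (δ * (ρ + σ))
          B = s * (1# + σ)

          -- The factor ρ + σ = ρ - ρ^q is nonzero because q-th powers move ρ.
          A≉0 : ¬ A ≈ 0#
          A≉0 = x*y≉0 m≉0 (x*y≉0 d≉0 (ρ^q≉ρ ∘ sym ∘ x∙y⁻¹≈ε⇒x≈y ρ (ρ ^ q)))

        -- The sum at ρ y together with σ times the sum at y; the weight σ = -ρ^q makes the linear
        -- contributions of all digits but the last cancel.
        terms : List Term
        terms = map (λ ζ → ζ ^ m , ζ * ρ , 1#) roots ++ map (λ ζ → σ * ζ ^ m , ζ , 1#) roots

        length-terms : length terms ≡ 2 ℕ.* suc m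
        length-terms = ≡.trans (length-++ (map (λ ζ → ζ ^ m , ζ * ρ , 1#) roots)) (≡.cong₂ ℕ._+_
          (≡.trans (length-map _ roots) size)
          (≡.trans (length-map _ roots) (≡.trans size (≡.sym (ℕ.+-identityʳ (suc m))))))

        ∑-terms : ∀ y → ∑ (λ t → ⟦ t ⟧ K y) terms ≈ B + A * y + ν * (remainder m (ρ * y) + σ * remainder m y)
        ∑-terms y = begin
          ∑ (λ t → ⟦ t ⟧ K y) terms
            ≈⟨ ∑-++ (λ t → ⟦ t ⟧ K y) (map (λ ζ → ζ ^ m , ζ * ρ , 1#) roots) _ ⟩
          _ + _
            ≈⟨ +-cong (∑-map (λ t → ⟦ t ⟧ K y) (λ ζ → ζ ^ m , ζ * ρ , 1#) roots)
                      (∑-map (λ t → ⟦ t ⟧ K y) (λ ζ → σ * ζ ^ m , ζ , 1#) roots) ⟩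
          ∑ (λ ζ → ζ ^ m * (1# + ζ * ρ * y) ^ K) roots + ∑ (λ ζ → σ * ζ ^ m * (1# + ζ * y) ^ K) roots
            ≈⟨ +-cong (∑-cong (λ ζ → *-congˡ (^-congˡ K (+-congˡ (*-assoc ζ ρ y)))) roots)
                      (trans (∑-cong (λ ζ → trans (*-assoc σ _ _) (*-comm σ _)) roots)
                             (∑-*ʳ (λ ζ → ζ ^ m * (1# + ζ * y) ^ K) σ roots)) ⟩
          ∑ (λ ζ → ζ ^ m * (1# + ζ * (ρ * y)) ^ K) roots + ∑ (λ ζ → ζ ^ m * (1# + ζ * y) ^ K) roots * σ
            ≈⟨ +-cong (trans (∑-powers fixed-q fixed-D (ρ * y)) (+-congˡ (*-congˡ (+-congʳ (+-congˡ G[ρy]≈ρ^q*G)))))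
                      (*-congʳ (∑-powers fixed-q fixed-D y)) ⟩
          (s + ν * (δ * (ρ * y) + ρ ^ q * G + remainder m (ρ * y))) + (s + ν * (δ * y + G + remainder m y)) * σ
            ≈⟨ lemma s ν δ ρ y (ρ ^ q) G (remainder m (ρ * y)) (remainder m y) σ ⟩
          B + A * y + ν * (remainder m (ρ * y) + σ * remainder m y) + ν * G * (ρ ^ q + σ)
            ≈⟨ +-congˡ (trans (*-congˡ (-‿inverseʳ (ρ ^ q))) (zeroʳ _)) ⟩
          B + A * y + ν * (remainder m (ρ * y) + σ * remainder m y) + 0#
            ≈⟨ +-identityʳ _ ⟩
          B + A * y + ν * (remainder m (ρ * y) + σ * remainder m y) ∎
          where
          G = ∑ id (digitPowers D ds (y ^ q))
          -- The digit powers start at y^q, so the scaling factor is ρ^q, and this has to be fixed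
          -- by D-th powers as ρ is.
          [ρ^q]^D≈ρ^q : (ρ ^ q) ^ D ≈ ρ ^ q
          [ρ^q]^D≈ρ^q = begin
            (ρ ^ q) ^ D     ≈⟨ ^-assocʳ ρ q D ⟩
            ρ ^ (q ℕ.* D)   ≡⟨ ≡.cong (ρ ^_) (ℕ.*-comm q D) ⟩
            ρ ^ (D ℕ.* q)   ≈⟨ ^-assocʳ ρ D q ⟨
            (ρ ^ D) ^ q     ≈⟨ ^-congˡ q ρ^D≈ρ ⟩
            ρ ^ q           ∎
          G[ρy]≈ρ^q*G : ∑ id (digitPowers D ds ((ρ * y) ^ q)) ≈ ρ ^ q * G
          G[ρy]≈ρ^q*G = ∑-digitPowers-scale D [ρ^q]^D≈ρ^q ds (^-distrib-* ρ y q)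
          lemma : ∀ s ν δ ρ y τ g u v σ →
            (s + ν * (δ * (ρ * y) + τ * g + u)) + (s + ν * (δ * y + g + v)) * σ ≈
            s * (1# + σ) + ν * (δ * (ρ + σ)) * y + ν * (u + σ * v) + ν * g * (τ + σ)
          lemma = solve 10 (λ s ν δ ρ y τ g u v σ →
            (s :+ ν :* (δ :* (ρ :* y) :+ τ :* g :+ u)) :+ (s :+ ν :* (δ :* y :+ g :+ v)) :* σ :=
            s :* (con 1 :+ σ) :+ ν :* (δ :* (ρ :+ σ)) :* y :+ ν :* (u :+ σ :* v) :+ ν :* g :* (τ :+ σ)) refl

        module _ {k l} .{{_ : ℕ.NonZero k}} (K≡l*k : K ≡ l ℕ.* k) where

          -- Both remainders vanish, so `terms` alone gives an affine function of y.
          everySumOf≤-< : d ℕ.+ sum ds < 2 ℕ.+ m → EverySumOf≤ (2 ℕ.* suc m) k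
          everySumOf≤-< γ<m+2 = ≡.subst (λ n → EverySumOf≤ n k) length-terms
            (affine⇒everySumOf≤ k l terms A≉0 λ y → ≡.subst (λ K → ∑ (λ t → ⟦ t ⟧ K y) terms ≈ B + A * y) K≡l*k (begin
              ∑ (λ t → ⟦ t ⟧ K y) terms ≈⟨ ∑-terms y ⟩
              B + A * y + ν * (remainder m (ρ * y) + σ * remainder m y)
                ≈⟨ +-congˡ (*-congˡ (+-cong (remainder≈0 m γ<m+2 (ρ * y)) (*-congˡ (remainder≈0 m γ<m+2 y)))) ⟩
              B + A * y + ν * (0# + σ * 0#)
                ≈⟨ lemma (B + A * y) ν σ ⟩
              B + A * y                 ∎))
            where
            lemma : ∀ u ν σ → u + ν * (0# + σ * 0#) ≈ u
            lemma = solve 3 (λ u ν σ → u :+ ν :* (con 0 :+ σ :* con 0) := u) refl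

          -- The remainders at ρ y and y are now ρ^K y^K and y^K. One more term, κ y^K, cancels what
          -- they contribute.
          everySumOf≤-≡ : d ℕ.+ sum ds ≡ 2 ℕ.+ m → EverySumOf≤ (suc (2 ℕ.* suc m)) k
          everySumOf≤-≡ γ≡m+2 = ≡.subst (λ n → EverySumOf≤ (suc n) k) length-terms
            (affine⇒everySumOf≤ k l ((κ , 1# , 0#) ∷ terms) A≉0 λ y →
              ≡.subst (λ K → ∑ (λ t → ⟦ t ⟧ K y) ((κ , 1# , 0#) ∷ terms) ≈ B + A * y) K≡l*k (begin
              κ * (0# + 1# * y) ^ K + ∑ (λ t → ⟦ t ⟧ K y) terms
                ≈⟨ +-cong (*-congˡ (^-congˡ K (trans (+-identityˡ _) (*-identityˡ y)))) (∑-terms y) ⟩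
              κ * y ^ K + (B + A * y + ν * (remainder m (ρ * y) + σ * remainder m y))
                ≈⟨ +-congˡ (+-congˡ (*-congˡ (+-cong
                     (trans (remainder≈z^exponent m γ≡m+2 (ρ * y)) (^-distrib-* ρ y K))
                     (*-congˡ (remainder≈z^exponent m γ≡m+2 y))))) ⟩
              κ * y ^ K + (B + A * y + ν * (ρ ^ K * y ^ K + σ * y ^ K))
                ≈⟨ lemma κ (y ^ K) (B + A * y) ν (ρ ^ K) σ ⟩
              B + A * y + (κ + ν * (ρ ^ K + σ)) * y ^ K
                ≈⟨ +-congˡ (trans (*-congʳ (-‿inverseˡ _)) (zeroˡ _)) ⟩
              B + A * y + 0#
                ≈⟨ +-identityʳ _ ⟩
              B + A * y                 ∎))
            where
            κ = - (ν * (ρ ^ K + σ))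
            lemma : ∀ κ u v ν r σ → κ * u + (v + ν * (r * u + σ * u)) ≈ v + (κ + ν * (r + σ)) * u
            lemma = solve 6 (λ κ u v ν r σ → κ :* u :+ (v :+ ν :* (r :* u :+ σ :* u))
                                          := v :+ (κ :+ ν :* (r :+ σ)) :* u) refl

  -- From the digits of k to the number of powers.

  x^[q^n]≈x : ∀ q {x} → x ^ q ≈ x → ∀ n → x ^ (q ℕ.^ n) ≈ x
  x^[q^n]≈x q {x} x^q≈x zero    = *-identityʳ x
  x^[q^n]≈x q {x} x^q≈x (suc n) =
    trans (sym (^-assocʳ x q (q ℕ.^ n))) (trans (^-congˡ (q ℕ.^ n) x^q≈x) (x^[q^n]≈x q x^q≈x n))

  everySumOf≤-mono : ∀ {s s′ k} → s ≤ s′ → EverySumOf≤ s k → EverySumOf≤ s′ k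
  everySumOf≤-mono s≤s′ sumOf f with n , g , n≤s , f≋ ← sumOf f = n , g , ℕ.≤-trans n≤s s≤s′ , f≋

  𝟏-refl : ∀ M → 𝟏 M M ≡ 1
  𝟏-refl M = ≡.cong (if_then 1 else 0) (dec-true (M ℕ.≟ M) ≡.refl)

  -- Here M = m + 2, and `d` is the last digit of k. The local lemmas turn the divisibility
  -- hypotheses into the facts about F that the sum over roots of unity requires.
  horner⇒everySumOf≤ : ∀ k q-1 .{{_ : ℕ.NonZero k}} .{{_ : ℕ.NonZero q-1}} d ds m →
    p ∣ suc q-1 → Additive (suc q-1) → Coprime k (suc q-1) → ¬ p ∣ k →
    horner (suc q-1) (d ∷ ds) ≡ k → suc m ∣ q-1 → d ℕ.+ sum ds ≤ 2 ℕ.+ m →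
    EverySumOf≤ (2 ℕ.* suc m ℕ.+ 𝟏 (2 ℕ.+ m) (d ℕ.+ sum ds)) k
  horner⇒everySumOf≤ k q-1 d ds m p∣q additive-q coprime p∤k horner≡k 1+m∣q-1 γ≤m+2 =
    let e , spread            = spread-digits coprime
        l , K≡l*k             = spread d ds horner≡k
        -- The same `e` as for the digits, so that `D` is both the base in which they are spread and
        -- an exponent fixing ρ.
        ρ , ρ^q≉ρ , ρ^D≈ρ     = moved-by-q q-1 e p∣q
        D                     = q ℕ.^ suc (suc e)
        additive-D            = additive-^ q additive-q (suc (suc e))
        fixed-D               = All.map (λ ζ^q≈ζ → x^[q^n]≈x q ζ^q≈ζ (suc (suc e))) fixed-q
    in  case ℕ.m≤n⇒m<n∨m≡n γ≤m+2 of λ where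
      (inj₁ γ<m+2) → everySumOf≤-mono {k = k} (ℕ.m≤m+n _ _)
        (everySumOf≤-< q D d ds μ additive-q additive-D γ≤m+2 fixed-q fixed-D ρ^q≉ρ ρ^D≈ρ d≉0 m≉0 {k} {l} K≡l*k γ<m+2)
      (inj₂ γ≡m+2) → everySumOf≤-mono {k = k} (ℕ.≤-reflexive (1+n≡n+𝟏 γ≡m+2))
        (everySumOf≤-≡ q D d ds μ additive-q additive-D γ≤m+2 fixed-q fixed-D ρ^q≉ρ ρ^D≈ρ d≉0 m≉0 {k} {l} K≡l*k γ≡m+2)
    where
    q = suc q-1

    -- If p divided m + 1, it would divide both q - 1 and q, hence 1.
    p∤1+m : ¬ p ∣ suc m
    p∤1+m p∣1+m = ¬prime[1] (≡.subst Prime (∣1⇒≡1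
      (∣m+n∣m⇒∣n (≡.subst (p ∣_) (ℕ.+-comm 1 q-1) p∣q) (∣-trans p∣1+m 1+m∣q-1))) p-prime)

    m≉0 : ¬ suc m × 1# ≈ 0#
    m≉0 = p∤n⇒n×1≉0 {suc m} p∤1+m

    -- k is `d` plus a multiple of q, and p divides q, so p dividing `d` would divide k.
    d≉0 : ¬ d × 1# ≈ 0#
    d≉0 = p∤n⇒n×1≉0 {d} λ p∣d → p∤k (≡.subst (p ∣_) horner≡k (∣m∣n⇒∣m+n p∣d (∣m⇒∣m*n (horner q ds) p∣q)))

    μ : UnityRoots (suc m)
    μ = unityRoots (suc m) p∤1+m

    -- ζ^(m+1) = 1 and m + 1 divides q - 1, so ζ^(q-1) = 1.
    fixed-q : All (λ ζ → ζ ^ q ≈ ζ) (UnityRoots.roots μ)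
    fixed-q = All.map (λ {ζ} ζ^[1+m]≈1 → begin
      ζ * ζ ^ q-1                              ≡⟨ ≡.cong (λ i → ζ * ζ ^ i) (m∣n⇒n≡m*quotient 1+m∣q-1) ⟩
      ζ * ζ ^ (suc m ℕ.* quotient 1+m∣q-1)     ≈⟨ *-congˡ (x^[m*n]≈1 (suc m) (quotient 1+m∣q-1) ζ^[1+m]≈1) ⟩
      ζ * 1#                                   ≈⟨ *-identityʳ ζ ⟩
      ζ                                        ∎) (UnityRoots.isRoot μ)

    1+n≡n+𝟏 : d ℕ.+ sum ds ≡ 2 ℕ.+ m →
              suc (2 ℕ.* suc m) ≡ 2 ℕ.* suc m ℕ.+ 𝟏 (2 ℕ.+ m) (d ℕ.+ sum ds)
    1+n≡n+𝟏 γ≡m+2 = ≡.trans (ℕ.+-comm 1 _) (≡.cong (2 ℕ.* suc m ℕ.+_)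
      (≡.sym (≡.trans (≡.cong (𝟏 (2 ℕ.+ m)) γ≡m+2) (𝟏-refl (2 ℕ.+ m)))))

  digits⇒everySumOf≤ : ∀ {q} .{{_ : ℕ.NonTrivial q}} (ds : Expansion q) {k} .{{_ : ℕ.NonZero k}} M .{{_ : ℕ.NonZero M}} →
    fromDigits ds ≡ k → p ∣ q → Additive q → Coprime k q → ¬ p ∣ k →
    M ℕ.∸ 1 ∣ q ℕ.∸ 1 → sum (map toℕ ds) ≤ M →
    EverySumOf≤ (2 ℕ.* (M ℕ.∸ 1) ℕ.+ 𝟏 M (sum (map toℕ ds))) k
  -- The empty expansion forces k = 0, which p would divide.
  digits⇒everySumOf≤ {suc (suc _)} [] M ≡.refl p∣q additive coprime p∤0 M-1∣q-1 γ≤M = contradiction (p ∣0) p∤0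
  -- For M = 1 the divisibility reads 0 ∣ q - 1, impossible since q ≥ 2.
  digits⇒everySumOf≤ {suc (suc _)} (d ∷ ds) (suc zero) fromDigits≡k p∣q additive coprime p∤k 0∣q-1 γ≤M
    with () ← 0∣⇒≡0 0∣q-1
  digits⇒everySumOf≤ {suc q-1@(suc _)} (d ∷ ds) {k} (suc (suc m)) fromDigits≡k =
    λ p∣q additive coprime p∤k → horner⇒everySumOf≤ k q-1 (toℕ d) (map toℕ ds) m p∣q additive coprime p∤k
      (≡.trans (≡.sym (fromDigits≡horner (d ∷ ds))) fromDigits≡k)

-- Comparison of the least number of powers with the bound.

least-≤ : ∀ {a} (em : ExcludedMiddle a) {P : ℕ → Set a} {s} → P s → proj₁ (least em P) ≤⁺ [ s ]
least-≤ em {P} Ps with least em P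
... | [ s′ ] , _ , minimal = [ minimal _ Ps ]
... | ⊤⁺     , ¬P          = contradiction Ps (¬P _)

open import Data.Nat.Base using (_+_; _*_; _∸_; _^_; NonZero)

theorem1 : ∀ {c ℓ} (em : ExcludedMiddle (c ⊔ ℓ)) →
    (F : CommutativeRing c ℓ) → IsAlgebraicallyClosedField F →
    (p : ℕ) (p-prime : Prime p) → HasCharacteristic F p →
    (k : ℕ) .{{_ : NonZero k}} → Coprime k p →
    (M n : ℕ) .{{_ : NonZero M}} .{{_ : NonZero n}} →
    γ (p ^ n) {{prime^-nonTrivial p-prime n}} k ≤ M →
    (M ∸ 1) ∣ (p ^ n ∸ 1) →
    Waring.v F em k ≤⁺ [ 2 * (M ∸ 1) + 𝟏 M (γ (p ^ n) {{prime^-nonTrivial p-prime n}} k) ]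
theorem1 em F closed p p-prime char k coprime M n γ≤M M-1∣q-1 =
  least-≤ em (digits⇒everySumOf≤ {{prime^-nonTrivial p-prime n}} (proj₁ expansion) M (proj₂ expansion)
    (m∣m^n p n) (additive-^ p additive-p n) (coprime-^ coprime n) p∤k M-1∣q-1 γ≤M)
  where
  open DigitSums em F closed p p-prime char
  open PrimeCharacteristic F closed p p-prime char
  -- These are the digits that define `γ`, so its value is their sum by definition.
  expansion = toDigits (p ^ n) {fromWitness (ℕ.nonTrivial⇒n>1 (p ^ n) {{prime^-nonTrivial p-prime n}})} k
  p∤k : ¬ p ∣ k
  p∤k p∣k = ¬prime[1] (≡.subst Prime (coprime (p∣k , ∣-refl)) p-prime)
  m∣m^n : ∀ m n .{{_ : ℕ.NonZero n}} → m ∣ m ℕ.^ n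
  m∣m^n m (suc n) = m∣m*n (m ℕ.^ n)
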